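{- For $n\ge1$, the number of isomorphism classes of micro-macro systems with $n$ microstates equals $$\sum_{k=1}^{n}\ \sum_{l\in\mathrm{par}_k(n)}\ \sum_{\pi\in\mathrm{Par}[k]}\ \prod_{c\in\pi}\sigma(c),\qquad\text{where } g_c=\gcd\{l_i: i\in c\},\quad \sigma(c)=\sum_{d\mid g_c} d^{|c|-1}.$$
   Context: A micro-macro system $(X,A,m,\alpha)$ consists of finite sets $X$ (microstates) and $A$ (macrostates), a bijection $\alpha:X\to X$ and a surjection $m:X\to A$. Two systems $(X_1,A_1,m_1,\alpha_1)$ and $(X_2,A_2,m_2,\alpha_2)$ are isomorphic if there is a bijection $\beta:X_1\to X_2$ with $\alpha_2=\beta\alpha_1\beta^{ -1}$ which induces a map $\widehat\beta:A_1\to A_2$ with $\widehat\beta m_1=m_2\beta$. $\mathrm{par}_k(n)$ is the set of sequences $l=(l_1,\dots,l_k)$ of positive integers with $l_1\ge\cdots\ge l_k$ and $\sum l_i=n$ (the cycle lengths of a permutation with $k$ cycles), and $\mathrm{Par}[k]$ is the set of set partitions of $[k]=\{1,\dots,k\}$; $|c|$ is the size of the block $c$.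
   Formalization: The induced map between the macrostate sets in the definition of isomorphism is required to be a bijection; with an arbitrary induced map the relation is not symmetric, so isomorphism classes would not be defined. -}

module Defs where

open import Data.Nat using (ℕ; zero; suc; _+_; _*_; _∸_; _^_; _≤ᵇ_; _≡ᵇ_)
open import Data.Nat.GCD using (gcd)
open import Data.Nat.Divisibility using (_∣?_)
open import Data.Fin using (Fin; toℕ)
open import Data.Fin.Permutation using (Permutation′; _⟨$⟩ʳ_)
open import Data.Fin.Properties using () renaming (_≟_ to _≟ᶠ_)
open import Data.Vec using (Vec; []; _∷_; lookup)
import Data.Vec as V
open import Data.List using (List; []; _∷_; [_]; map; concatMap; filter; filterᵇ; foldr; length; upTo; allFin; and)
open import Data.Nat.ListAction using (sum; product)
open import Data.Bool using (Bool; true; false; _∧_)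
open import Data.Product using (Σ; ∃; _×_)
open import Relation.Nullary.Decidable using (⌊_⌋)
open import Relation.Binary.PropositionalEquality using (_≡_)

-- Micro-macro systems with n microstates.
-- Microstates X = Fin n (every finite X with |X| = n is in bijection with
-- Fin n), macrostates A = Fin a for some a.

record MMSystem (n : ℕ) : Set where
  field
    a    : ℕ
    α    : Permutation′ n
    m    : Fin n → Fin a
    surj : ∀ (y : Fin a) → ∃ λ x → m x ≡ y

open MMSystem public

Iso : ∀ {n} → MMSystem n → MMSystem n → Set
Iso {n} S T =
  Σ (Permutation′ n) λ β →
  Σ (Data.Fin.Permutation.Permutation (a S) (a T)) λ β̂ →
    (∀ x → α T ⟨$⟩ʳ (β ⟨$⟩ʳ x) ≡ β ⟨$⟩ʳ (α S ⟨$⟩ʳ x))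
    × (∀ x → β̂ ⟨$⟩ʳ (m S x) ≡ m T (β ⟨$⟩ʳ x))

all : ∀ {A : Set} → (A → Bool) → List A → Bool
all p = foldr (λ x b → p x ∧ b) true

allVecs : (k m : ℕ) → List (Vec (Fin m) k)
allVecs zero    m = [ [] ]
allVecs (suc k) m = concatMap (λ x → map (x ∷_) (allVecs k m)) (allFin m)

nonincreasing : List ℕ → Bool
nonincreasing []           = true
nonincreasing (x ∷ [])     = true
nonincreasing (x ∷ y ∷ xs) = (y ≤ᵇ x) ∧ nonincreasing (y ∷ xs)

isPar : ℕ → List ℕ → Bool
isPar n ls = all (λ x → 1 ≤ᵇ x) ls ∧ nonincreasing ls ∧ (sum ls ≡ᵇ n)

par : (k n : ℕ) → List (Vec ℕ k)
par k n = filterᵇ (λ l → isPar n (V.toList l)) (map (V.map toℕ) (allVecs k (suc n)))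

-- Par[k]: a set partition of [k] = Fin k is encoded by the map sending each
-- element to the least element of its block, i.e. f : Fin k → Fin k with
-- f i ≤ i and f (f i) = f i (this encoding is a bijection).
isSetPar : ∀ {k} → Vec (Fin k) k → Bool
isSetPar {k} f = all (λ i → (toℕ (lookup f i) ≤ᵇ toℕ i)
                           ∧ ⌊ lookup f (lookup f i) ≟ᶠ lookup f i ⌋) (allFin k)

SetPar : (k : ℕ) → List (Vec (Fin k) k)
SetPar k = filterᵇ isSetPar (allVecs k k)

-- the blocks of the partition encoded by f: one per least element r
blocks : ∀ {k} → Vec (Fin k) k → List (List (Fin k))
blocks {k} f =
  map (λ r → filterᵇ (λ i → ⌊ lookup f i ≟ᶠ r ⌋) (allFin k))
      (filterᵇ (λ r → ⌊ lookup f r ≟ᶠ r ⌋) (allFin k))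

σ : List ℕ → ℕ
σ ls = sum (map (λ d → d ^ (length ls ∸ 1)) (filter (_∣? g) (map suc (upTo g))))
  where g = foldr gcd 0 ls

formula : ℕ → ℕ
formula n =
  sum (map (λ k →
    sum (map (λ l →
      sum (map (λ π → product (map (λ c → σ (map (lookup l) c)) (blocks π)))
               (SetPar k)))
      (par k n)))
    (map suc (upTo n)))

{-# OPTIONS --safe #-}
-- A system is, up to isomorphism, an orbit of the symmetric group on pairs of
-- a permutation and an equivalence relation. By a Burnside argument (count the
-- triples (a , R , g) where g commutes with a and fixes R, once by the pair
-- (a , R) and once by g) the number of these orbits is the sum, over conjugacy
-- classes of permutations g, of the number of g-invariant equivalence relations.
-- Conjugacy classes are the cycle types l. An invariant relation for cycle
-- type l partitions the cycles into blocks; on a block c it is given by a period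
-- d dividing every cycle length in c and, for each cycle of c other than the
-- least one, an offset modulo d. That is σ(c) choices for every block.
module Submission where

open import Defs
open import Data.Nat using (ℕ; zero; suc; _+_; _*_; _∸_; _^_; _≤_; _<_; _≥_; _≤ᵇ_; z≤n; s≤s; NonZero; >-nonZero; _≟_)
open import Data.Nat.Properties hiding (_≟_)
open import Data.Nat.DivMod using (_%_; _/_; m≡m%n+[m/n]*n; m%n<n; m<n⇒m%n≡m; [m+kn]%n≡m%n)
open import Data.Nat.Divisibility using (_∣_; _∣?_; divides; ∣-trans; ∣-antisym; ∣⇒≤; _∣0; ∣m+n∣m⇒∣n; n∣m*n)
open import Data.Nat.GCD using (gcd; gcd[m,n]∣m; gcd[m,n]∣n; gcd-greatest)
open import Data.Nat.Induction using (<-wellFounded)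
open import Data.Nat.ListAction using (sum; product)
open import Data.Nat.ListAction.Properties using (sum-++)
open import Data.Nat.Tactic.RingSolver using (solve-∀)
open import Data.Bool using (Bool; true; false; T)
open import Data.Bool.Properties using (T?; T-∧) renaming (_≟_ to _≟ᵇ_)
open import Data.Fin using (Fin; zero; suc; toℕ; fromℕ<; _↑ˡ_; _↑ʳ_; splitAt)
open import Data.Fin.Properties using (all?; any?; pigeonhole; toℕ<n; toℕ-fromℕ<; toℕ-injective; ↑ˡ-injective; ↑ʳ-injective; splitAt-↑ˡ; splitAt-↑ʳ; join-splitAt; fromℕ<-cong) renaming (_≟_ to _≟ᶠ_)
open import Data.Fin.Permutation using (Permutation′; permutation; _⟨$⟩ʳ_; _⟨$⟩ˡ_) renaming (inverseˡ to ⟨$⟩-inverseˡ; inverseʳ to ⟨$⟩-inverseʳ)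
open import Data.Vec using (Vec; []; _∷_; lookup; tabulate; toList; fromList)
import Data.Vec as V
open import Data.Vec.Properties using (∷-injective; ≡-dec; lookup-map; lookup∘tabulate; tabulate∘lookup; tabulate-cong; toList-map; toList∘fromList)
open import Data.List using (List; []; _∷_; [_]; _++_; map; concatMap; filter; filterᵇ; foldr; deduplicate; cartesianProduct; length; upTo; allFin)
import Data.List as L
open import Data.List.Properties using (length-map; length-++; length-upTo; length-tabulate; map-++; map-∘; map-cong; map-tabulate; ∷-injectiveˡ; ∷-injectiveʳ)
open import Data.List.Membership.Propositional using (_∈_; find; lose)
open import Data.List.Membership.Propositional.Properties using (∈-map⁺; ∈-map⁻; ∈-filter⁺; ∈-filter⁻; ∈-++⁺ˡ; ∈-++⁺ʳ; ∈-++⁻; ∈-concatMap⁺; ∈-concatMap⁻; ∈-cartesianProduct⁺; ∈-cartesianProduct⁻; ∈-∃++; ∈-allFin; ∈-lookup; ∈-length; ∈-upTo⁺; ∈-upTo⁻)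
open import Data.List.Membership.Propositional.Properties.WithK using (unique∧set⇒bag)
open import Data.List.Relation.Binary.BagAndSetEquality using (∼bag⇒↭)
open import Data.List.Relation.Binary.Permutation.Propositional using (_↭_; ↭⇒↭ₛ; ↭-sym)
import Data.List.Relation.Binary.Permutation.Propositional.Properties as ↭
import Data.List.Relation.Binary.Permutation.Setoid.Properties as ↭ₛ
open import Data.List.Relation.Binary.Pointwise using (Pointwise; []; _∷_; Pointwise-≡⇒≡; Pointwise-length)
open import Data.List.Relation.Unary.All as All using (All; []; _∷_)
open import Data.List.Relation.Unary.All.Properties using (all-filter)
import Data.List.Relation.Unary.Any as Any
open import Data.List.Relation.Unary.Any using (here; there; index)
open import Data.List.Relation.Unary.Any.Properties using (lookup-index)
import Data.List.Relation.Unary.AllPairs as AllPairs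
open import Data.List.Relation.Unary.AllPairs using (AllPairs; []; _∷_)
import Data.List.Relation.Unary.AllPairs.Properties as AllPairs
open import Data.List.Relation.Unary.Linked using (Linked; []; [-]; _∷_)
import Data.List.Relation.Unary.Linked.Properties as Linked
open import Data.List.Relation.Unary.Sorted.TotalOrder.Properties using (↗↭↗⇒≋)
import Data.List.Sort as Sort
open import Data.List.Relation.Unary.Unique.Propositional using (Unique)
import Data.List.Relation.Unary.Unique.Propositional.Properties as Unique
open import Data.Product using (Σ; ∃; ∃₂; _×_; _,_; proj₁; proj₂; swap)
import Data.Product.Properties as Product
open import Data.Sum using (_⊎_; inj₁; inj₂)
open import Data.Empty using (⊥-elim)
open import Data.Unit using (tt)
open import Function using (_∘_; _∋_; mk⇔)
open import Function.Bundles using (Equivalence)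
open import Induction.WellFounded using (Acc; acc)
open import Relation.Nullary using (¬_; Dec; yes; no; ¬?)
open import Relation.Nullary.Decidable using (⌊_⌋; does; map′; _×-dec_; _→-dec_; dec-true; toWitness; fromWitness)
open import Relation.Unary using () renaming (Decidable to Decidable₁)
open import Relation.Binary.Definitions using (Decidable; DecidableEquality)
open import Relation.Binary.Structures using (IsEquivalence)
import Relation.Binary.Construct.Flip.EqAndOrd as Flip
import Relation.Binary.Construct.On as On
open import Relation.Binary.PropositionalEquality hiding ([_])

-- Finite sums, products and counting

-- The Burnside step rests on a symmetry: `g` fixes `a` under conjugation exactly when the two
-- commute, hence exactly when `a` fixes `g`. So the number of pairs fixed by `g` is the order of
-- the centraliser of `g` times the number of relations fixed by `g`, and the centraliser order
-- balances the size of the conjugacy class. Nothing is divided: both counts are kept as multiples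
-- of the group order. Orbits are not formed as sets; each family of orbits is represented by a list
-- of pairwise inequivalent points that meets every orbit, and lists are compared in length through
-- a matching relation. The delicate point of the local count is a normal form. A relation
-- determines its offsets only modulo the period and only relative to a base cycle, so the base is
-- the least cycle of the block, its offset is 0, and the others are reduced below the period. To
-- avoid negative numbers, the points of a cycle are addressed by all natural numbers, congruent
-- ones naming the same point, and steps backwards are replaced by enough steps forwards.

private variable
  A B : Set
  P : A → Set

∑ : List A → (A → ℕ) → ℕ
∑ xs f = sum (map f xs)

∏ : List A → (A → ℕ) → ℕ
∏ xs f = product (map f xs)

𝟙 : {P : Set} → Dec P → ℕ
𝟙 (yes _) = 1
𝟙 (no _)  = 0

𝟙-yes : {P : Set} (d : Dec P) → P → 𝟙 d ≡ 1
𝟙-yes (yes _) _ = refl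
𝟙-yes (no ¬p) p = ⊥-elim (¬p p)

𝟙-no : {P : Set} (d : Dec P) → ¬ P → 𝟙 d ≡ 0
𝟙-no (yes p) ¬p = ⊥-elim (¬p p)
𝟙-no (no _)  _  = refl

𝟙-× : {P Q R : Set} (p : Dec P) (q : Dec Q) (r : Dec R) →
      (R → P × Q) → (P → Q → R) → 𝟙 r ≡ 𝟙 p * 𝟙 q
𝟙-× (yes p) (yes q) r _ g = 𝟙-yes r (g p q)
𝟙-× (yes p) (no ¬q) r f _ = 𝟙-no r (¬q ∘ proj₂ ∘ f)
𝟙-× (no ¬p) _       r f _ = 𝟙-no r (¬p ∘ proj₁ ∘ f)

∑-cong : ∀ {f g : A → ℕ} xs → (∀ {x} → x ∈ xs → f x ≡ g x) → ∑ xs f ≡ ∑ xs g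
∑-cong []       _ = refl
∑-cong (x ∷ xs) e = cong₂ _+_ (e (here refl)) (∑-cong xs (e ∘ there))

∏-cong : ∀ {f g : A → ℕ} xs → (∀ x → f x ≡ g x) → ∏ xs f ≡ ∏ xs g
∏-cong []       _ = refl
∏-cong (x ∷ xs) e = cong₂ _*_ (e x) (∏-cong xs e)

∑-zero : ∀ {f : A → ℕ} xs → (∀ {x} → x ∈ xs → f x ≡ 0) → ∑ xs f ≡ 0
∑-zero []       _ = refl
∑-zero (x ∷ xs) e = cong₂ _+_ (e (here refl)) (∑-zero xs (e ∘ there))

∑-one : ∀ (xs : List A) → ∑ xs (λ _ → 1) ≡ length xs
∑-one []       = refl
∑-one (x ∷ xs) = cong suc (∑-one xs)

∏-one : ∀ (xs : List A) → ∏ xs (λ _ → 1) ≡ 1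
∏-one []       = refl
∏-one (x ∷ xs) = trans (+-identityʳ _) (∏-one xs)

∑-+ : ∀ (f g : A → ℕ) xs → ∑ xs (λ x → f x + g x) ≡ ∑ xs f + ∑ xs g
∑-+ f g []       = refl
∑-+ f g (x ∷ xs) = trans (cong (f x + g x +_) (∑-+ f g xs)) (interchange (f x) (g x) (∑ xs f) (∑ xs g))
  where
  interchange : ∀ a b c d → a + b + (c + d) ≡ a + c + (b + d)
  interchange = solve-∀

∏-* : ∀ (f g : A → ℕ) xs → ∏ xs (λ x → f x * g x) ≡ ∏ xs f * ∏ xs g
∏-* f g []       = refl
∏-* f g (x ∷ xs) = trans (cong (f x * g x *_) (∏-* f g xs)) ([m*n]*[o*p]≡[m*o]*[n*p] (f x) (g x) (∏ xs f) (∏ xs g))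

∑-*ˡ : ∀ c (f : A → ℕ) xs → c * ∑ xs f ≡ ∑ xs (λ x → c * f x)
∑-*ˡ c f []       = *-zeroʳ c
∑-*ˡ c f (x ∷ xs) = trans (*-distribˡ-+ c (f x) _) (cong (c * f x +_) (∑-*ˡ c f xs))

∑-*ʳ : ∀ c (f : A → ℕ) xs → ∑ xs f * c ≡ ∑ xs (λ x → f x * c)
∑-*ʳ c f []       = refl
∑-*ʳ c f (x ∷ xs) = trans (*-distribʳ-+ c (f x) _) (cong (f x * c +_) (∑-*ʳ c f xs))

∑-swap : ∀ (f : A → B → ℕ) xs ys → ∑ xs (λ x → ∑ ys (f x)) ≡ ∑ ys (λ y → ∑ xs (λ x → f x y))
∑-swap f []       ys = sym (∑-zero ys λ _ → refl)
∑-swap f (x ∷ xs) ys = trans (cong (∑ ys (f x) +_) (∑-swap f xs ys)) (sym (∑-+ (f x) _ ys))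

∏-swap : ∀ (f : A → B → ℕ) xs ys → ∏ xs (λ x → ∏ ys (f x)) ≡ ∏ ys (λ y → ∏ xs (λ x → f x y))
∏-swap f []       ys = sym (∏-one ys)
∏-swap f (x ∷ xs) ys = trans (cong (∏ ys (f x) *_) (∏-swap f xs ys)) (sym (∏-* (f x) _ ys))

∑-++ : ∀ (f : A → ℕ) xs ys → ∑ (xs ++ ys) f ≡ ∑ xs f + ∑ ys f
∑-++ f xs ys = trans (cong sum (map-++ f xs ys)) (sum-++ (map f xs) (map f ys))

∑-map : ∀ (f : B → ℕ) (h : A → B) xs → ∑ (map h xs) f ≡ ∑ xs (f ∘ h)
∑-map f h xs = cong sum (sym (map-∘ xs))

∑-concatMap : ∀ (f : B → ℕ) (h : A → List B) xs → ∑ (concatMap h xs) f ≡ ∑ xs (λ x → ∑ (h x) f)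
∑-concatMap f h []       = refl
∑-concatMap f h (x ∷ xs) = trans (∑-++ f (h x) (concatMap h xs)) (cong (∑ (h x) f +_) (∑-concatMap f h xs))

∑-cartesianProduct : ∀ (f : A × B → ℕ) xs ys →
  ∑ (cartesianProduct xs ys) f ≡ ∑ xs (λ x → ∑ ys (λ y → f (x , y)))
∑-cartesianProduct f []       ys = refl
∑-cartesianProduct f (x ∷ xs) ys = trans (∑-++ f (map (x ,_) ys) (cartesianProduct xs ys))
  (cong₂ _+_ (∑-map f (x ,_) ys) (∑-cartesianProduct f xs ys))

length-concatMap : ∀ (h : A → List B) xs → length (concatMap h xs) ≡ ∑ xs (length ∘ h)
length-concatMap h []       = refl
length-concatMap h (x ∷ xs) = trans (length-++ (h x)) (cong (length (h x) +_) (length-concatMap h xs))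

∑-single : ∀ {f : A → ℕ} {xs x₀} → Unique xs → x₀ ∈ xs → (∀ {x} → x ∈ xs → x ≢ x₀ → f x ≡ 0) → ∑ xs f ≡ f x₀
∑-single {f = f} {x ∷ xs} (x∉ ∷ _) (here refl) e =
  trans (cong (f x +_) (∑-zero xs λ y∈ → e (there y∈) (All.lookup x∉ y∈ ∘ sym))) (+-identityʳ _)
∑-single {xs = x ∷ xs} (x∉ ∷ u) (there x₀∈) e =
  cong₂ _+_ (e (here refl) (All.lookup x∉ x₀∈)) (∑-single u x₀∈ (e ∘ there))

∑-𝟙 : ∀ (P? : Decidable₁ {A = A} P) xs → ∑ xs (𝟙 ∘ P?) ≡ length (filter P? xs)
∑-𝟙 P? []       = refl
∑-𝟙 P? (x ∷ xs) with P? x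
... | yes _ = cong suc (∑-𝟙 P? xs)
... | no  _ = ∑-𝟙 P? xs

∏-filter : ∀ (P? : Decidable₁ {A = A} P) (f : A → ℕ) (g : A → ℕ) xs →
           (∀ {x} → P x → g x ≡ f x) → (∀ {x} → ¬ P x → g x ≡ 1) → ∏ (filter P? xs) f ≡ ∏ xs g
∏-filter P? f g []       _ _ = refl
∏-filter P? f g (x ∷ xs) e e′ with P? x
... | yes p = cong₂ _*_ (sym (e p)) (∏-filter P? f g xs e e′)
... | no ¬p = trans (∏-filter P? f g xs e e′) (sym (trans (cong (_* ∏ xs g) (e′ ¬p)) (+-identityʳ _)))

-- Induction on `xs`: a partner of the head is cut out of `ys`, and injectivity keeps the partners
-- of the tail away from it. A relation suffices, so no inverse map has to be written down in later
-- counts.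
Unique⇒length≤ : ∀ {xs : List A} {ys : List B} (R : A → B → Set) → Unique xs →
  (∀ {x} → x ∈ xs → ∃ λ y → y ∈ ys × R x y) →
  (∀ {x x′ y} → x ∈ xs → x′ ∈ xs → R x y → R x′ y → x ≡ x′) → length xs ≤ length ys
Unique⇒length≤ {xs = []}     R u tot inj = z≤n
Unique⇒length≤ {xs = x ∷ xs} R (x∉ ∷ u) tot inj with tot (here refl)
... | y , y∈ , xRy with ∈-∃++ y∈
... | as , bs , refl = subst (suc (length xs) ≤_) (sym (trans (length-++ as) (trans (+-suc _ _) (cong suc (sym (length-++ as))))))
    (s≤s (Unique⇒length≤ {ys = as ++ bs} R u tot′ λ p q → inj (there p) (there q)))
  where
  tot′ : ∀ {x′} → x′ ∈ xs → ∃ λ y′ → y′ ∈ as ++ bs × R x′ y′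
  tot′ x′∈ with tot (there x′∈)
  ... | y′ , y′∈ , r with ∈-++⁻ as y′∈
  ... | inj₁ p            = y′ , ∈-++⁺ˡ p , r
  ... | inj₂ (here refl)  = ⊥-elim (All.lookup x∉ x′∈ (inj (here refl) (there x′∈) xRy r))
  ... | inj₂ (there p)    = y′ , ∈-++⁺ʳ as p , r

bijection⇒length≡ : ∀ {xs : List A} {ys : List B} (R : A → B → Set) → Unique xs → Unique ys →
  (∀ {x} → x ∈ xs → ∃ λ y → y ∈ ys × R x y) →
  (∀ {y} → y ∈ ys → ∃ λ x → x ∈ xs × R x y) →
  (∀ {x x′ y} → x ∈ xs → x′ ∈ xs → R x y → R x′ y → x ≡ x′) →
  (∀ {x y y′} → y ∈ ys → y′ ∈ ys → R x y → R x y′ → y ≡ y′) →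
  length xs ≡ length ys
bijection⇒length≡ R u v l r i j =
  ≤-antisym (Unique⇒length≤ R u l i) (Unique⇒length≤ (λ y x → R x y) v r j)

Unique-concatMap : ∀ {xs : List A} (h : A → List B) → Unique xs →
  (∀ {x} → x ∈ xs → Unique (h x)) →
  (∀ {x x′ y} → x ∈ xs → x′ ∈ xs → y ∈ h x → y ∈ h x′ → x ≡ x′) →
  Unique (concatMap h xs)
Unique-concatMap {xs = []} h [] u d = []
Unique-concatMap {xs = x ∷ xs} h (x∉ ∷ uxs) u d = Unique.++⁺ (u (here refl))
  (Unique-concatMap h uxs (u ∘ there) λ p q → d (there p) (there q))
  λ (p , q) → let (x′ , x′∈ , q′) = find (∈-concatMap⁻ h q) in All.lookup x∉ x′∈ (d (here refl) (there x′∈) p q′)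

AllPairs-∈ : ∀ {R : A → A → Set} {xs x y} → (∀ {x y} → R x y → R y x) → AllPairs R xs →
             x ∈ xs → y ∈ xs → x ≢ y → R x y
AllPairs-∈ s (r ∷ rs) (here refl) (here refl) x≢y = ⊥-elim (x≢y refl)
AllPairs-∈ s (r ∷ rs) (here refl) (there q)   x≢y = All.lookup r q
AllPairs-∈ s (r ∷ rs) (there p)   (here refl) x≢y = s (All.lookup r p)
AllPairs-∈ s (r ∷ rs) (there p)   (there q)   x≢y = AllPairs-∈ s rs p q x≢y

AllPairs-lookup : ∀ {R : A → A → Set} {xs} → (∀ {x y} → R x y → R y x) → AllPairs R xs →
                  ∀ i j → i ≢ j → R (L.lookup xs i) (L.lookup xs j)
AllPairs-lookup s (r ∷ rs) zero    zero    i≢j = ⊥-elim (i≢j refl)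
AllPairs-lookup s (r ∷ rs) zero    (suc j) i≢j = All.lookup r (∈-lookup j)
AllPairs-lookup s (r ∷ rs) (suc i) zero    i≢j = s (All.lookup r (∈-lookup i))
AllPairs-lookup s (r ∷ rs) (suc i) (suc j) i≢j = AllPairs-lookup s rs i j (i≢j ∘ cong suc)

module _ {E : A → A → Set} (E? : Decidable E) (eq : IsEquivalence E) where

  deduplicate-cover : ∀ {x} xs → x ∈ xs → ∃ λ r → r ∈ deduplicate E? xs × E x r
  deduplicate-cover (x₀ ∷ xs) (here refl) = x₀ , here refl , IsEquivalence.refl eq
  deduplicate-cover (x₀ ∷ xs) (there x∈) with deduplicate-cover xs x∈
  ... | r , r∈ , e with E? x₀ r
  ...   | yes e′ = x₀ , here refl , IsEquivalence.trans eq e (IsEquivalence.sym eq e′)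
  ...   | no ¬e  = r , there (∈-filter⁺ (¬? ∘ E? x₀) r∈ ¬e) , e

  deduplicate-apart : ∀ xs → AllPairs (λ r s → ¬ E r s) (deduplicate E? xs)
  deduplicate-apart []       = []
  deduplicate-apart (x ∷ xs) = all-filter _ (deduplicate E? xs) ∷ AllPairs.filter⁺ _ (deduplicate-apart xs)

  deduplicate-⊆ : ∀ {r} xs → r ∈ deduplicate E? xs → r ∈ xs
  deduplicate-⊆ (x ∷ xs) (here refl) = here refl
  deduplicate-⊆ (x ∷ xs) (there r∈)  = there (deduplicate-⊆ xs (proj₁ (∈-filter⁻ (¬? ∘ E? x) r∈)))

choose : ∀ {R : A → B → Set} xs → (∀ {x} → x ∈ xs → ∃ (R x)) → ∃ λ ys → Pointwise R xs ys
choose []       f = [] , []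
choose (x ∷ xs) f = let (y , r) = f (here refl); (ys , rs) = choose xs (f ∘ there) in y ∷ ys , r ∷ rs

Pointwise-∈ˡ : ∀ {R : A → B → Set} {xs ys x} → Pointwise R xs ys → x ∈ xs → ∃ λ y → y ∈ ys × R x y
Pointwise-∈ˡ (r ∷ rs) (here refl) = _ , here refl , r
Pointwise-∈ˡ (r ∷ rs) (there x∈)  = let (y , y∈ , s) = Pointwise-∈ˡ rs x∈ in y , there y∈ , s

Pointwise-∈ʳ : ∀ {R : A → B → Set} {xs ys y} → Pointwise R xs ys → y ∈ ys → ∃ λ x → x ∈ xs × R x y
Pointwise-∈ʳ (r ∷ rs) (here refl) = _ , here refl , r
Pointwise-∈ʳ (r ∷ rs) (there y∈)  = let (x , x∈ , s) = Pointwise-∈ʳ rs y∈ in x , there x∈ , s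

Pointwise-AllPairs : ∀ {R : A → B → Set} {S : A → A → Set} {T : B → B → Set} {xs ys} →
  (∀ {x x′ y y′} → R x y → R x′ y′ → S x x′ → T y y′) → Pointwise R xs ys → AllPairs S xs → AllPairs T ys
Pointwise-AllPairs f []       []       = []
Pointwise-AllPairs f (r ∷ rs) (s ∷ ss) =
  All.tabulate (λ y′∈ → let (x′ , x′∈ , r′) = Pointwise-∈ʳ rs y′∈ in f r r′ (All.lookup s x′∈))
  ∷ Pointwise-AllPairs f rs ss

∑-Pointwise : ∀ {R : A → B → Set} {f : A → ℕ} {g : B → ℕ} {xs ys} →
  (∀ {x y} → R x y → f x ≡ g y) → Pointwise R xs ys → ∑ xs f ≡ ∑ ys g
∑-Pointwise e []       = refl
∑-Pointwise e (r ∷ rs) = cong₂ _+_ (e r) (∑-Pointwise e rs)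

-- Families of independent choices

choices : ∀ {k} → (Fin k → List A) → List (Vec A k)
choices {k = zero}  L = [ [] ]
choices {k = suc k} L = concatMap (λ x → map (x ∷_) (choices (L ∘ suc))) (L zero)

allVecs≡choices : ∀ k m → allVecs k m ≡ choices {k = k} (λ _ → allFin m)
allVecs≡choices zero    m = refl
allVecs≡choices (suc k) m = cong (λ vs → concatMap (λ x → map (x ∷_) vs) (allFin m)) (allVecs≡choices k m)

∈-choices⁺ : ∀ {k} {L : Fin k → List A} v → (∀ i → lookup v i ∈ L i) → v ∈ choices L
∈-choices⁺ []      e = here refl
∈-choices⁺ (x ∷ v) e = ∈-concatMap⁺ _ (lose (e zero) (∈-map⁺ (x ∷_) (∈-choices⁺ v (e ∘ suc))))

∈-choices⁻ : ∀ {k} (L : Fin k → List A) {v} → v ∈ choices L → ∀ i → lookup v i ∈ L i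
∈-choices⁻ {k = suc k} L v∈ i with find (∈-concatMap⁻ _ {xs = L zero} v∈)
... | x , x∈ , p with ∈-map⁻ (x ∷_) p
∈-choices⁻ {k = suc k} L v∈ zero    | x , x∈ , p | v , v∈′ , refl = x∈
∈-choices⁻ {k = suc k} L v∈ (suc i) | x , x∈ , p | v , v∈′ , refl = ∈-choices⁻ (L ∘ suc) v∈′ i

choices-unique : ∀ {k} (L : Fin k → List A) → (∀ i → Unique (L i)) → Unique (choices L)
choices-unique {k = zero}  L u = [] ∷ []
choices-unique {k = suc k} L u = Unique-concatMap _ (u zero)
  (λ _ → Unique.map⁺ (proj₂ ∘ ∷-injective) (choices-unique (L ∘ suc) (u ∘ suc)))
  λ {x} {x′} _ _ p q → let (_ , _ , e) = ∈-map⁻ (x ∷_) p ; (_ , _ , e′) = ∈-map⁻ (x′ ∷_) q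
                       in proj₁ (∷-injective (trans (sym e) e′))

∏ᶠ : ∀ k → (Fin k → ℕ) → ℕ
∏ᶠ zero    f = 1
∏ᶠ (suc k) f = f zero * ∏ᶠ k (f ∘ suc)

∏-allFin : ∀ k (f : Fin k → ℕ) → ∏ (allFin k) f ≡ ∏ᶠ k f
∏-allFin k f = trans (cong product (map-tabulate (λ i → i) f)) (go k f)
  where
  go : ∀ k (f : Fin k → ℕ) → product (L.tabulate f) ≡ ∏ᶠ k f
  go zero    f = refl
  go (suc k) f = cong (f zero *_) (go k (f ∘ suc))

-- The distributive law. It later turns a sum over families of periods, one for each block, into a
-- product of divisor sums.
∑-choices : ∀ {k} (L : Fin k → List A) (w : Fin k → A → ℕ) →
  ∑ (choices L) (λ v → ∏ᶠ k (λ i → w i (lookup v i))) ≡ ∏ᶠ k (λ i → ∑ (L i) (w i))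
∑-choices {k = zero}  L w = refl
∑-choices {k = suc k} L w = begin
  ∑ (choices L) W                                           ≡⟨ ∑-concatMap W _ (L zero) ⟩
  ∑ (L zero) (λ x → ∑ (map (x ∷_) (choices (L ∘ suc))) W)   ≡⟨ ∑-cong (L zero) (λ {x} _ → ∑-map W (x ∷_) (choices (L ∘ suc))) ⟩
  ∑ (L zero) (λ x → ∑ (choices (L ∘ suc)) (W ∘ (x ∷_)))     ≡⟨ ∑-cong (L zero) (λ {x} _ → sym (∑-*ˡ (w zero x) _ (choices (L ∘ suc)))) ⟩
  ∑ (L zero) (λ x → w zero x * ∑ (choices (L ∘ suc)) W′)    ≡⟨ sym (∑-*ʳ (∑ (choices (L ∘ suc)) W′) (w zero) (L zero)) ⟩
  ∑ (L zero) (w zero) * ∑ (choices (L ∘ suc)) W′            ≡⟨ cong (∑ (L zero) (w zero) *_) (∑-choices (L ∘ suc) (w ∘ suc)) ⟩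
  ∑ (L zero) (w zero) * ∏ᶠ k (λ i → ∑ (L (suc i)) (w (suc i))) ∎
  where
  open ≡-Reasoning
  W : Vec _ (suc k) → ℕ
  W v = ∏ᶠ (suc k) (λ i → w i (lookup v i))
  W′ : Vec _ k → ℕ
  W′ v = ∏ᶠ k (λ i → w (suc i) (lookup v i))

∏ᶠ-cong : ∀ k {f g : Fin k → ℕ} → (∀ i → f i ≡ g i) → ∏ᶠ k f ≡ ∏ᶠ k g
∏ᶠ-cong zero    e = refl
∏ᶠ-cong (suc k) e = cong₂ _*_ (e zero) (∏ᶠ-cong k (e ∘ suc))

length-choices : ∀ {k} (L : Fin k → List A) → length (choices L) ≡ ∏ᶠ k (length ∘ L)
length-choices {k = k} L = begin
  length (choices L)                      ≡⟨ sym (∑-one (choices L)) ⟩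
  ∑ (choices L) (λ _ → 1)                 ≡⟨ ∑-cong (choices L) (λ _ → sym (one k)) ⟩
  ∑ (choices L) (λ _ → ∏ᶠ k (λ _ → 1))    ≡⟨ ∑-choices L (λ _ _ → 1) ⟩
  ∏ᶠ k (λ i → ∑ (L i) (λ _ → 1))          ≡⟨ ∏ᶠ-cong k (λ i → ∑-one (L i)) ⟩
  ∏ᶠ k (length ∘ L) ∎
  where
  open ≡-Reasoning
  one : ∀ k → ∏ᶠ k (λ _ → 1) ≡ 1
  one zero    = refl
  one (suc k) = trans (+-identityʳ _) (one k)

-- Counting orbits

-- The group is the list `elements`; `Carrier` may be larger, and the inverse laws are asked for
-- only on the list. Permutations can thus be plain pairs of tables, with no proofs inside them to
-- obstruct equality.
record FiniteGroup : Set₁ where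
  infixl 7 _∙_
  field
    Carrier  : Set
    elements : List Carrier
    _∙_      : Carrier → Carrier → Carrier
    ε        : Carrier
    _⁻¹      : Carrier → Carrier
    unique    : Unique elements
    ε-closed  : ε ∈ elements
    ∙-closed  : ∀ {g h} → g ∈ elements → h ∈ elements → (g ∙ h) ∈ elements
    ⁻¹-closed : ∀ {g} → g ∈ elements → (g ⁻¹) ∈ elements
    assoc     : ∀ g h k → (g ∙ h) ∙ k ≡ g ∙ (h ∙ k)
    identityˡ : ∀ g → ε ∙ g ≡ g
    identityʳ : ∀ g → g ∙ ε ≡ g
    inverseˡ  : ∀ {g} → g ∈ elements → g ⁻¹ ∙ g ≡ ε
    inverseʳ  : ∀ {g} → g ∈ elements → g ∙ g ⁻¹ ≡ ε
    ⁻¹-anti   : ∀ g h → (g ∙ h) ⁻¹ ≡ h ⁻¹ ∙ g ⁻¹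
    _≟ᴳ_      : DecidableEquality Carrier

  cancelʳ : ∀ {g} h → g ∈ elements → (h ∙ g) ∙ g ⁻¹ ≡ h
  cancelʳ h g∈ = trans (assoc h _ _) (trans (cong (h ∙_) (inverseʳ g∈)) (identityʳ h))

  cancelʳ′ : ∀ {g} h → g ∈ elements → (h ∙ g ⁻¹) ∙ g ≡ h
  cancelʳ′ h g∈ = trans (assoc h _ _) (trans (cong (h ∙_) (inverseˡ g∈)) (identityʳ h))

record Action (𝔾 : FiniteGroup) : Set₁ where
  open FiniteGroup 𝔾
  infixr 8 _·_
  field
    Point    : Set
    points   : List Point
    unique-points : Unique points
    _≟ₚ_      : DecidableEquality Point
    _·_      : Carrier → Point → Point
    ·-closed : ∀ {g x} → g ∈ elements → x ∈ points → (g · x) ∈ points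
    ·-∙      : ∀ g h x → (g ∙ h) · x ≡ g · (h · x)
    ·-ε      : ∀ x → ε · x ≡ x

  ·-⁻¹ : ∀ {g} x → g ∈ elements → (g ⁻¹) · (g · x) ≡ x
  ·-⁻¹ {g} x g∈ = trans (sym (·-∙ (g ⁻¹) g x)) (trans (cong (_· x) (inverseˡ g∈)) (·-ε x))

  Orbit : Point → Point → Set
  Orbit x y = ∃ λ g → g ∈ elements × g · x ≡ y

  orbit? : Decidable Orbit
  orbit? x y with Any.any? (λ g → (g · x) ≟ₚ y) elements
  ... | yes p = yes (find p)
  ... | no ¬p = no λ (g , g∈ , e) → ¬p (lose g∈ e)

  orbit-equivalence : IsEquivalence Orbit
  orbit-equivalence = record
    { refl  = ε , ε-closed , ·-ε _
    ; sym   = λ { (g , g∈ , refl) → g ⁻¹ , ⁻¹-closed g∈ , ·-⁻¹ _ g∈ }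
    ; trans = λ { (g , g∈ , refl) (h , h∈ , refl) → h ∙ g , ∙-closed h∈ g∈ , ·-∙ h g _ }
    }

  open IsEquivalence orbit-equivalence public using ()
    renaming (refl to orbit-refl; sym to orbit-sym; trans to orbit-trans)

  transporters : Point → Point → ℕ
  transporters x y = ∑ elements (λ g → 𝟙 ((g · x) ≟ₚ y))

  stabilizer : Point → ℕ
  stabilizer x = transporters x x

  -- Every group element carries `x` to exactly one point.
  ∑-transporters : ∀ {x} → x ∈ points → ∑ points (transporters x) ≡ length elements
  ∑-transporters {x} x∈ = begin
    ∑ points (transporters x)                                 ≡⟨ ∑-swap _ points elements ⟩
    ∑ elements (λ g → ∑ points (λ y → 𝟙 ((g · x) ≟ₚ y)))       ≡⟨ ∑-cong elements (λ {g} g∈ →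
         trans (∑-single unique-points (·-closed g∈ x∈) λ _ ne → 𝟙-no (_ ≟ₚ _) (ne ∘ sym)) (𝟙-yes (_ ≟ₚ _) refl)) ⟩
    ∑ elements (λ _ → 1)                                      ≡⟨ ∑-one elements ⟩
    length elements ∎
    where open ≡-Reasoning

  transporters≡0 : ∀ {x y} → ¬ Orbit x y → transporters x y ≡ 0
  transporters≡0 ¬o = ∑-zero elements λ g∈ → 𝟙-no (_ ≟ₚ _) λ e → ¬o (_ , g∈ , e)

  -- The elements carrying `x` to `y` form a coset of the stabiliser of `y`: right multiplication by
  -- the inverse of one fixed transporter matches the two.
  transporters≡stabilizer : ∀ {x y} → Orbit x y → transporters x y ≡ stabilizer y
  transporters≡stabilizer {x} {y} (g , g∈ , gx≡y) = begin
    transporters x y                              ≡⟨ ∑-𝟙 (λ h → (h · x) ≟ₚ y) elements ⟩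
    length (filter (λ h → (h · x) ≟ₚ y) elements)  ≡⟨ bijection⇒length≡ (λ h h′ → h ∙ g ⁻¹ ≡ h′)
      (Unique.filter⁺ _ unique) (Unique.filter⁺ _ unique) to from
      (λ p q e e′ → trans (sym (cancelʳ′ _ g∈)) (trans (cong (_∙ g) (trans e (sym e′))) (cancelʳ′ _ g∈)))
      (λ p q e e′ → trans (sym e) e′) ⟩
    length (filter (λ h → (h · y) ≟ₚ y) elements)  ≡⟨ sym (∑-𝟙 (λ h → (h · y) ≟ₚ y) elements) ⟩
    stabilizer y ∎
    where
    open ≡-Reasoning
    g⁻¹y≡x : g ⁻¹ · y ≡ x
    g⁻¹y≡x = trans (cong (g ⁻¹ ·_) (sym gx≡y)) (·-⁻¹ x g∈)
    to : ∀ {h} → h ∈ filter (λ h → (h · x) ≟ₚ y) elements →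
         ∃ λ h′ → h′ ∈ filter (λ h → (h · y) ≟ₚ y) elements × h ∙ g ⁻¹ ≡ h′
    to {h} h∈ = let (p , e) = ∈-filter⁻ _ h∈ in h ∙ g ⁻¹ ,
      ∈-filter⁺ _ (∙-closed p (⁻¹-closed g∈)) (trans (·-∙ h (g ⁻¹) y) (trans (cong (h ·_) g⁻¹y≡x) e)) , refl
    from : ∀ {h′} → h′ ∈ filter (λ h → (h · y) ≟ₚ y) elements →
           ∃ λ h → h ∈ filter (λ h → (h · x) ≟ₚ y) elements × h ∙ g ⁻¹ ≡ h′
    from {h} h∈ = let (p , e) = ∈-filter⁻ _ h∈ in h ∙ g ,
      ∈-filter⁺ _ (∙-closed p g∈) (trans (·-∙ h g x) (trans (cong (h ·_) gx≡y) e)) , cancelʳ h g∈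

  -- Stands in for the set of orbits: the length of such a list is their number.
  record Transversal (rs : List Point) : Set where
    field
      ⊆points : ∀ {r} → r ∈ rs → r ∈ points
      apart   : AllPairs (λ r s → ¬ Orbit r s) rs
      cover   : ∀ {x} → x ∈ points → ∃ λ r → r ∈ rs × Orbit x r

  -- Weighted orbit-stabiliser theorem without division. The group order at each representative is
  -- spread over the points as transporters; at a point only the representative of its own orbit
  -- contributes, and by the coset count it contributes the stabiliser.
  ∑-stabilizer : ∀ {rs} (W : Point → ℕ) → Transversal rs →
    (∀ {g x} → g ∈ elements → x ∈ points → W (g · x) ≡ W x) →
    ∑ points (λ x → W x * stabilizer x) ≡ length elements * ∑ rs W
  ∑-stabilizer {rs} W t inv = sym (begin
    length elements * ∑ rs W                                ≡⟨ *-comm (length elements) _ ⟩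
    ∑ rs W * length elements                                ≡⟨ ∑-*ʳ (length elements) W rs ⟩
    ∑ rs (λ r → W r * length elements)                      ≡⟨ ∑-cong rs (λ {r} r∈ → trans
       (cong (W r *_) (sym (∑-transporters (⊆points r∈)))) (∑-*ˡ (W r) _ points)) ⟩
    ∑ rs (λ r → ∑ points (λ x → W r * transporters r x))    ≡⟨ ∑-swap _ rs points ⟩
    ∑ points (λ x → ∑ rs (λ r → W r * transporters r x))    ≡⟨ ∑-cong points one ⟩
    ∑ points (λ x → W x * stabilizer x) ∎)
    where
    open ≡-Reasoning
    open Transversal t
    rs-unique : Unique rs
    rs-unique = AllPairs.map (λ { ¬o refl → ¬o orbit-refl }) apart
    one : ∀ {x} → x ∈ points → ∑ rs (λ r → W r * transporters r x) ≡ W x * stabilizer x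
    one {x} x∈ with cover x∈
    ... | r , r∈ , x~r@(g , g∈ , gx≡r) = trans
      (∑-single rs-unique r∈ λ {s} s∈ s≢r → trans (cong (W s *_) (transporters≡0 λ s~x →
         AllPairs-∈ (λ ¬o → ¬o ∘ orbit-sym) apart s∈ r∈ s≢r (orbit-trans s~x x~r))) (*-zeroʳ (W s)))
      (cong₂ _*_ (trans (cong W (sym gx≡r)) (inv g∈ x∈)) (transporters≡stabilizer (orbit-sym x~r)))

  fixed : Carrier → ℕ
  fixed g = ∑ points (λ x → 𝟙 ((g · x) ≟ₚ x))

  -- Acting by `g` maps the fixed points of `h` onto those of its conjugate. Hence `fixed` is a
  -- class function and an admissible weight for `∑-stabilizer` under conjugation.
  fixed-conjugate : ∀ {g h} → g ∈ elements → fixed ((g ∙ h) ∙ g ⁻¹) ≡ fixed h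
  fixed-conjugate {g} {h} g∈ = trans (∑-𝟙 _ points) (trans
    (bijection⇒length≡ (λ x y → g · y ≡ x) (Unique.filter⁺ _ unique-points) (Unique.filter⁺ _ unique-points)
      to from (λ _ _ e e′ → trans (sym e) e′)
      (λ _ _ e e′ → trans (sym (·-⁻¹ _ g∈)) (trans (cong (g ⁻¹ ·_) (trans e (sym e′))) (·-⁻¹ _ g∈))))
    (sym (∑-𝟙 _ points)))
    where
    conj : ∀ y → ((g ∙ h) ∙ g ⁻¹) · (g · y) ≡ g · (h · y)
    conj y = trans (·-∙ (g ∙ h) (g ⁻¹) _) (trans (cong ((g ∙ h) ·_) (·-⁻¹ y g∈)) (·-∙ g h y))
    undo : ∀ x → g · (g ⁻¹ · x) ≡ x
    undo x = trans (sym (·-∙ g (g ⁻¹) x)) (trans (cong (_· x) (inverseʳ g∈)) (·-ε x))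
    to : ∀ {x} → x ∈ filter (λ x → (((g ∙ h) ∙ g ⁻¹) · x) ≟ₚ x) points →
         ∃ λ y → y ∈ filter (λ x → (h · x) ≟ₚ x) points × g · y ≡ x
    to {x} x∈ = let (p , e) = ∈-filter⁻ _ x∈ in g ⁻¹ · x ,
      ∈-filter⁺ _ (·-closed (⁻¹-closed g∈) p)
        (trans (sym (·-⁻¹ _ g∈)) (cong (g ⁻¹ ·_) (trans (sym (conj _)) (trans (cong (((g ∙ h) ∙ g ⁻¹) ·_) (undo x)) e)))) ,
      undo x
    from : ∀ {y} → y ∈ filter (λ x → (h · x) ≟ₚ x) points →
           ∃ λ x → x ∈ filter (λ x → (((g ∙ h) ∙ g ⁻¹) · x) ≟ₚ x) points × g · y ≡ x
    from {y} y∈ = let (p , e) = ∈-filter⁻ _ y∈ in g · y ,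
      ∈-filter⁺ _ (·-closed g∈ p) (trans (conj y) (cong (g ·_) e)) , refl

module _ (𝔾 : FiniteGroup) where
  open FiniteGroup 𝔾

  conjugation : Action 𝔾
  conjugation = record
    { Point = Carrier ; points = elements ; unique-points = unique ; _≟ₚ_ = _≟ᴳ_
    ; _·_      = λ g a → (g ∙ a) ∙ g ⁻¹
    ; ·-closed = λ g∈ a∈ → ∙-closed (∙-closed g∈ a∈) (⁻¹-closed g∈)
    ; ·-∙      = λ g h a → begin
        ((g ∙ h) ∙ a) ∙ (g ∙ h) ⁻¹          ≡⟨ cong₂ _∙_ (assoc g h a) (⁻¹-anti g h) ⟩
        (g ∙ (h ∙ a)) ∙ (h ⁻¹ ∙ g ⁻¹)       ≡⟨ sym (assoc _ _ _) ⟩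
        ((g ∙ (h ∙ a)) ∙ h ⁻¹) ∙ g ⁻¹       ≡⟨ cong (_∙ g ⁻¹) (assoc _ _ _) ⟩
        (g ∙ ((h ∙ a) ∙ h ⁻¹)) ∙ g ⁻¹ ∎
    ; ·-ε      = λ a → begin
        (ε ∙ a) ∙ ε ⁻¹  ≡⟨ cong₂ _∙_ (identityˡ a) (trans (sym (identityˡ _)) (inverseʳ ε-closed)) ⟩
        a ∙ ε           ≡⟨ identityʳ a ⟩
        a ∎
    }
    where open ≡-Reasoning

  module Conj = Action conjugation

  -- Both equations say that `a` and `g` commute, so the two may exchange roles.
  conjugate-fixes : ∀ {g a} → g ∈ elements → a ∈ elements → g Conj.· a ≡ a → a Conj.· g ≡ g
  conjugate-fixes {g} {a} g∈ a∈ e = begin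
    (a ∙ g) ∙ a ⁻¹                   ≡⟨ cong (λ x → (x ∙ g) ∙ a ⁻¹) (sym e) ⟩
    (((g ∙ a) ∙ g ⁻¹) ∙ g) ∙ a ⁻¹    ≡⟨ cong (_∙ a ⁻¹) (cancelʳ′ _ g∈) ⟩
    (g ∙ a) ∙ a ⁻¹                   ≡⟨ cancelʳ g a∈ ⟩
    g ∎
    where open ≡-Reasoning

  module _ (𝒴 : Action 𝔾) where
    private module Y = Action 𝒴

    pairing : Action 𝔾
    pairing = record
      { Point = Carrier × Y.Point
      ; points = cartesianProduct elements Y.points
      ; unique-points = Unique.cartesianProduct⁺ unique Y.unique-points
      ; _≟ₚ_ = Product.≡-dec _≟ᴳ_ Y._≟ₚ_
      ; _·_ = λ g (a , y) → g Conj.· a , g Y.· y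
      ; ·-closed = λ g∈ ay∈ → let (a∈ , y∈) = ∈-cartesianProduct⁻ elements Y.points ay∈
                               in ∈-cartesianProduct⁺ (Conj.·-closed g∈ a∈) (Y.·-closed g∈ y∈)
      ; ·-∙ = λ g h (a , y) → cong₂ _,_ (Conj.·-∙ g h a) (Y.·-∙ g h y)
      ; ·-ε = λ (a , y) → cong₂ _,_ (Conj.·-ε a) (Y.·-ε y)
      }

    private module P = Action pairing

    -- Both sides, multiplied by the group order, count the triples (a , y , g)
    -- with g commuting with a and fixing y: grouping by (a , y) gives
    -- the orbits of pairs, grouping by g gives the conjugacy classes.
    length-pairing-transversal : ∀ {rs cs} → P.Transversal rs → Conj.Transversal cs →
                                 length rs ≡ ∑ cs Y.fixed
    length-pairing-transversal {rs} {cs} tr tc = *-cancelˡ-≡ _ _ (length elements)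
      {{>-nonZero (∈-length ε-closed)}} (begin
        length elements * length rs                                    ≡⟨ cong (length elements *_) (sym (∑-one rs)) ⟩
        length elements * ∑ rs (λ _ → 1)                               ≡⟨ sym (P.∑-stabilizer (λ _ → 1) tr λ _ _ → refl) ⟩
        ∑ P.points (λ x → 1 * P.stabilizer x)                          ≡⟨ ∑-cong P.points (λ _ → *-identityˡ _) ⟩
        ∑ P.points P.stabilizer                                        ≡⟨ ∑-swap _ P.points elements ⟩
        ∑ elements (λ g → ∑ P.points (λ x → 𝟙 ((g P.· x) P.≟ₚ x)))     ≡⟨ ∑-cong elements fix ⟩
        ∑ elements (λ g → Y.fixed g * Conj.stabilizer g)               ≡⟨ Conj.∑-stabilizer Y.fixed tc (λ {g} {h} g∈ _ → Y.fixed-conjugate g∈) ⟩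
        length elements * ∑ cs Y.fixed ∎)
      where
      open ≡-Reasoning
      -- The condition on the first component is turned round by `conjugate-fixes`, so that it
      -- counts the stabiliser of `g` and no longer involves the relation.
      fix : ∀ {g} → g ∈ elements → ∑ P.points (λ x → 𝟙 ((g P.· x) P.≟ₚ x)) ≡ Y.fixed g * Conj.stabilizer g
      fix {g} g∈ = begin
        ∑ P.points (λ x → 𝟙 ((g P.· x) P.≟ₚ x))
          ≡⟨ ∑-cartesianProduct _ elements Y.points ⟩
        ∑ elements (λ a → ∑ Y.points (λ y → 𝟙 ((g P.· (a , y)) P.≟ₚ (a , y))))
          ≡⟨ ∑-cong elements (λ {a} a∈ → ∑-cong Y.points λ {y} _ →
               𝟙-× ((a Conj.· g) Conj.≟ₚ g) ((g Y.· y) Y.≟ₚ y) _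
                 (λ e → conjugate-fixes g∈ a∈ (cong proj₁ e) , cong proj₂ e)
                 (λ e e′ → cong₂ _,_ (conjugate-fixes a∈ g∈ e) e′)) ⟩
        ∑ elements (λ a → ∑ Y.points (λ y → 𝟙 ((a Conj.· g) Conj.≟ₚ g) * 𝟙 ((g Y.· y) Y.≟ₚ y)))
          ≡⟨ ∑-cong elements (λ {a} _ → sym (∑-*ˡ (𝟙 ((a Conj.· g) Conj.≟ₚ g)) _ Y.points)) ⟩
        ∑ elements (λ a → 𝟙 ((a Conj.· g) Conj.≟ₚ g) * Y.fixed g)
          ≡⟨ sym (∑-*ʳ (Y.fixed g) _ elements) ⟩
        Conj.stabilizer g * Y.fixed g
          ≡⟨ *-comm (Conj.stabilizer g) _ ⟩
        Y.fixed g * Conj.stabilizer g ∎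

-- Congruences and periods

-- Congruence modulo d, phrased without subtraction; modulo 0 it is equality.
Mod : ℕ → ℕ → ℕ → Set
Mod d s t = ∃₂ λ a b → s + a * d ≡ t + b * d

Mod-refl : ∀ {d s} → Mod d s s
Mod-refl = 0 , 0 , refl

Mod-reflexive : ∀ {d s t} → s ≡ t → Mod d s t
Mod-reflexive refl = Mod-refl

Mod-sym : ∀ {d s t} → Mod d s t → Mod d t s
Mod-sym (a , b , e) = b , a , sym e

Mod-+ : ∀ {d s t u v} → Mod d s t → Mod d u v → Mod d (s + u) (t + v)
Mod-+ {d} {s} {t} {u} {v} (a , b , e) (a′ , b′ , e′) = a + a′ , b + b′ ,
  trans (regroup s u a a′ d) (trans (cong₂ _+_ e e′) (sym (regroup t v b b′ d)))
  where
  regroup : ∀ s u a a′ d → s + u + (a + a′) * d ≡ (s + a * d) + (u + a′ * d)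
  regroup = solve-∀

Mod-cancel : ∀ {d} c {s t} → Mod d (c + s) (c + t) → Mod d s t
Mod-cancel {d} c {s} {t} (a , b , e) = a , b ,
  +-cancelˡ-≡ c _ _ (trans (sym (+-assoc c s _)) (trans e (+-assoc c t _)))

-- The two congruences are added and the common term `t` is cancelled.
Mod-trans : ∀ {d s t u} → Mod d s t → Mod d t u → Mod d s u
Mod-trans {d} {s} {t} {u} p q =
  Mod-cancel t (subst₂ (Mod d) (+-comm s t) refl (Mod-+ p q))

Mod-∣ : ∀ {d e s t} → d ∣ e → Mod e s t → Mod d s t
Mod-∣ {d} {s = s} {t} (divides q refl) (a , b , eq) = a * q , b * q ,
  trans (cong (s +_) (*-assoc a q d)) (trans eq (cong (t +_) (sym (*-assoc b q d))))

Mod-*ˡ : ∀ {d} a s → Mod d s (s + a * d)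
Mod-*ˡ a s = a , 0 , sym (+-identityʳ _)

Mod-0⇒∣ : ∀ {d m} → Mod d 0 m → d ∣ m
Mod-0⇒∣ {d} {m} (a , b , e) = ∣m+n∣m⇒∣n (subst (d ∣_) (trans e (+-comm m _)) (n∣m*n a)) (n∣m*n b)

∣⇒Mod-0 : ∀ {d m} → d ∣ m → Mod d 0 m
∣⇒Mod-0 (divides q refl) = Mod-*ˡ q 0

Mod-% : ∀ d .{{_ : NonZero d}} s → Mod d (s % d) s
Mod-% d s = s / d , 0 , trans (sym (m≡m%n+[m/n]*n s d)) (sym (+-identityʳ s))

Mod⇒%≡ : ∀ d .{{_ : NonZero d}} {s t} → Mod d s t → s % d ≡ t % d
Mod⇒%≡ d {s} {t} (a , b , e) =
  trans (sym ([m+kn]%n≡m%n s a d)) (trans (cong (_% d) e) ([m+kn]%n≡m%n t b d))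

%≡⇒Mod : ∀ d .{{_ : NonZero d}} {s t} → s % d ≡ t % d → Mod d s t
%≡⇒Mod d {s} {t} e = Mod-trans (Mod-sym (Mod-% d s)) (Mod-trans (Mod-reflexive e) (Mod-% d t))

Mod-< : ∀ {d s t} → s < d → t < d → Mod d s t → s ≡ t
Mod-< {d@(suc _)} s<d t<d p =
  trans (sym (m<n⇒m%n≡m s<d)) (trans (Mod⇒%≡ d p) (m<n⇒m%n≡m t<d))

-- Modulus 0 has to be covered because `aligned?` reads its modulus from an arbitrary vector, where
-- nothing ensures positivity.
Mod? : ∀ d → Decidable (Mod d)
Mod? zero s t with s ≟ t
... | yes refl = yes Mod-refl
... | no s≢t = no λ (a , b , e) → s≢t (begin
    s          ≡⟨ sym (+-identityʳ s) ⟩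
    s + 0      ≡⟨ cong (s +_) (sym (*-zeroʳ a)) ⟩
    s + a * 0  ≡⟨ e ⟩
    t + b * 0  ≡⟨ cong (t +_) (*-zeroʳ b) ⟩
    t + 0      ≡⟨ +-identityʳ t ⟩
    t          ∎)
  where open ≡-Reasoning
Mod? d@(suc _) s t with s % d ≟ t % d
... | yes e = yes (%≡⇒Mod d e)
... | no ne = no (ne ∘ Mod⇒%≡ d)

-- A natural number playing the part of -s: s times (modulus - 1), since adding s gives s times the
-- modulus.
Mod-negate : ∀ {d} → 0 < d → ∀ s → ∃ λ u → Mod d (s + u) 0
Mod-negate {suc d} _ s = s * d , Mod-sym (∣⇒Mod-0 (divides s (sym (*-suc s d))))

least : ∀ {P : ℕ → Set} (P? : Decidable₁ P) {n} → P n → ∃ λ m → P m × (∀ {j} → j < m → ¬ P j)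
least {P} P? {n} p = go n (<-wellFounded n) p
  where
  go : ∀ n → Acc _<_ n → P n → ∃ λ m → P m × (∀ {j} → j < m → ¬ P j)
  go n (acc rs) p with anyUpTo? P? n
  ... | yes (j , j<n , pj) = go j (rs j<n) pj
  ... | no ¬any = n , p , λ {j} j<n pj → ¬any (j , j<n , pj)

-- Common form of two situations: coincidence of the iterates of a permutation, and an invariant
-- relation restricted to a single cycle.
record Shift (E : ℕ → ℕ → Set) : Set where
  field
    decidable   : Decidable E
    equivalence : IsEquivalence E
    shift⁺      : ∀ c {s t} → E s t → E (c + s) (c + t)
    shift⁻      : ∀ c {s t} → E (c + s) (c + t) → E s t

IsPeriod : (E : ℕ → ℕ → Set) → ℕ → Set
IsPeriod E d = 0 < d × (∀ {s t} → E s t → Mod d s t) × (∀ {s t} → Mod d s t → E s t)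

-- The least positive number related to 0 is the period: its multiples are related by translation,
-- and two related residues below it must coincide, since their difference would be a smaller such
-- number.
period : ∀ {E} → Shift E → ∀ {N} → 0 < N → E 0 N → ∃ (IsPeriod E)
-- The search runs over the predecessor of the period, which makes the result positive.
period {E} sh {suc N} _ e0N with least (λ d → decidable 0 (suc d)) e0N
  where open Shift sh
... | d′ , e0d , minimal = d , s≤s z≤n , E⇒Mod , Mod⇒E
  where
  open Shift sh
  open IsEquivalence equivalence renaming (refl to Erefl; sym to Esym; trans to Etrans)
  d : ℕ
  d = suc d′
  multiple : ∀ a → E 0 (a * d)
  multiple zero    = Erefl
  multiple (suc a) = Etrans e0d (subst (λ x → E x (d + a * d)) (+-identityʳ d) (shift⁺ d (multiple a)))
  shifted : ∀ s a → E s (s + a * d)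
  shifted s a = subst (λ x → E x (s + a * d)) (+-identityʳ s) (shift⁺ s (multiple a))
  Mod⇒E : ∀ {s t} → Mod d s t → E s t
  Mod⇒E {s} {t} (a , b , e) = Etrans (shifted s a) (subst (λ x → E x t) (sym e) (Esym (shifted t b)))
  small : ∀ {s t} → s ≤ t → t < d → E s t → s ≡ t
  small {s} {t} s≤t t<d e with t ∸ s in eq | shift⁻ s (subst₂ E (sym (+-identityʳ s)) (sym (m+[n∸m]≡n s≤t)) e)
  ... | zero  | _   = ≤-antisym s≤t (m∸n≡0⇒m≤n eq)
  -- Translating back by `s` relates 0 to the difference `suc j`, which is positive and below `d`,
  -- against minimality.
  ... | suc j | e0j = ⊥-elim (minimal (≤-pred (≤-trans (s≤s (subst (_≤ t) eq (m∸n≤m t s))) t<d)) e0j)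
  E⇒Mod : ∀ {s t} → E s t → Mod d s t
  E⇒Mod {s} {t} e = %≡⇒Mod d (go (≤-total (s % d) (t % d)))
    where
    e′ : E (s % d) (t % d)
    e′ = Etrans (Mod⇒E (Mod-% d s)) (Etrans e (Mod⇒E (Mod-sym (Mod-% d t))))
    go : s % d ≤ t % d ⊎ t % d ≤ s % d → s % d ≡ t % d
    go (inj₁ le) = small le (m%n<n t d) e′
    go (inj₂ le) = sym (small le (m%n<n s d) (Esym e′))

Mod-modulus : ∀ {d e s t} → d ≡ e → Mod d s t → Mod e s t
Mod-modulus refl p = p

-- The symmetric group acting on equivalence relations

lookup-ext : ∀ {A : Set} {n} {v w : Vec A n} → (∀ i → lookup v i ≡ lookup w i) → v ≡ w
lookup-ext {v = v} {w} e = trans (sym (tabulate∘lookup v)) (trans (tabulate-cong e) (tabulate∘lookup w))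

-- A permutation is stored together with its inverse, as two tables of values.
Perm : ℕ → Set
Perm n = Vec (Fin n) n × Vec (Fin n) n

module _ {n : ℕ} where

  app : Perm n → Fin n → Fin n
  app g = lookup (proj₁ g)

  app⁻¹ : Perm n → Fin n → Fin n
  app⁻¹ g = lookup (proj₂ g)

  record IsPerm (g : Perm n) : Set where
    constructor _,_
    field
      invʳ : ∀ x → app g (app⁻¹ g x) ≡ x
      invˡ : ∀ x → app⁻¹ g (app g x) ≡ x

  open IsPerm public

  isPerm? : Decidable₁ IsPerm
  isPerm? g = map′ (λ (r , l) → r , l) (λ p → invʳ p , invˡ p)
    (all? (λ x → app g (app⁻¹ g x) ≟ᶠ x) ×-dec all? (λ x → app⁻¹ g (app g x) ≟ᶠ x))

  -- For genuine permutations the forward table determines the inverse table.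
  perm-ext : ∀ {g h} → IsPerm g → IsPerm h → (∀ x → app g x ≡ app h x) → g ≡ h
  perm-ext {g} {h} (gl , gr) (hl , hr) e = cong₂ _,_ (lookup-ext e) (lookup-ext λ x →
    trans (cong (app⁻¹ g) (trans (sym (hl x)) (sym (e _)))) (gr _))

  infixr 9 _∘ᵛ_
  _∘ᵛ_ : Vec (Fin n) n → Vec (Fin n) n → Vec (Fin n) n
  v ∘ᵛ w = tabulate (λ x → lookup v (lookup w x))

  lookup-∘ᵛ : ∀ v w x → lookup (v ∘ᵛ w) x ≡ lookup v (lookup w x)
  lookup-∘ᵛ v w = lookup∘tabulate _

  idᵛ : Vec (Fin n) n
  idᵛ = tabulate (λ x → x)

  ∘ᵛ-assoc : ∀ u v w → (u ∘ᵛ v) ∘ᵛ w ≡ u ∘ᵛ v ∘ᵛ w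
  ∘ᵛ-assoc u v w = tabulate-cong λ x →
    trans (lookup-∘ᵛ u v (lookup w x)) (cong (lookup u) (sym (lookup-∘ᵛ v w x)))

  ∘ᵛ-identityˡ : ∀ v → idᵛ ∘ᵛ v ≡ v
  ∘ᵛ-identityˡ v = trans (tabulate-cong λ x → lookup∘tabulate _ (lookup v x)) (tabulate∘lookup v)

  ∘ᵛ-identityʳ : ∀ v → v ∘ᵛ idᵛ ≡ v
  ∘ᵛ-identityʳ v = trans (tabulate-cong λ x → cong (lookup v) (lookup∘tabulate _ x)) (tabulate∘lookup v)

  perms : List (Perm n)
  perms = filter isPerm? (cartesianProduct (allVecs n n) (allVecs n n))

  ∈-allVecs : ∀ {k} (v : Vec (Fin n) k) → v ∈ allVecs k n
  ∈-allVecs {k} v = subst (v ∈_) (sym (allVecs≡choices k n)) (∈-choices⁺ v λ i → ∈-allFin _)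

  allVecs-unique : ∀ k → Unique (allVecs k n)
  allVecs-unique k = subst Unique (sym (allVecs≡choices k n)) (choices-unique _ λ _ → Unique.allFin⁺ n)

  ∈-perms⁺ : ∀ {g} → IsPerm g → g ∈ perms
  ∈-perms⁺ {g} p = ∈-filter⁺ isPerm? (∈-cartesianProduct⁺ (∈-allVecs (proj₁ g)) (∈-allVecs (proj₂ g))) p

  ∈-perms⁻ : ∀ {g} → g ∈ perms → IsPerm g
  ∈-perms⁻ g∈ = proj₂ (∈-filter⁻ isPerm? {xs = cartesianProduct (allVecs n n) (allVecs n n)} g∈)

symmetricGroup : ℕ → FiniteGroup
symmetricGroup n = record
  { Carrier   = Perm n
  ; elements  = perms
  ; _∙_       = λ g h → (proj₁ g ∘ᵛ proj₁ h) , (proj₂ h ∘ᵛ proj₂ g)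
  ; ε         = idᵛ , idᵛ
  ; _⁻¹       = swap
  ; unique    = Unique.filter⁺ isPerm? (Unique.cartesianProduct⁺ (allVecs-unique n) (allVecs-unique n))
  ; ε-closed  = ∈-perms⁺ (id-id , id-id)
  ; ∙-closed  = λ {g} {h} g∈ h∈ → let (gl , gr) = ∈-perms⁻ g∈ ; (hl , hr) = ∈-perms⁻ h∈ in
      ∈-perms⁺ ( (λ x → trans (lookup-∘ᵛ (proj₁ g) (proj₁ h) _)
                   (trans (cong (λ z → app g (app h z)) (lookup-∘ᵛ (proj₂ h) (proj₂ g) x))
                   (trans (cong (app g) (hl _)) (gl x))))
               , (λ x → trans (lookup-∘ᵛ (proj₂ h) (proj₂ g) _)
                   (trans (cong (λ z → app⁻¹ h (app⁻¹ g z)) (lookup-∘ᵛ (proj₁ g) (proj₁ h) x))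
                   (trans (cong (app⁻¹ h) (gr _)) (hr x)))))
  ; ⁻¹-closed = λ g∈ → ∈-perms⁺ (invˡ (∈-perms⁻ g∈) , invʳ (∈-perms⁻ g∈))
  ; assoc     = λ g h k → cong₂ _,_ (∘ᵛ-assoc (proj₁ g) (proj₁ h) (proj₁ k)) (sym (∘ᵛ-assoc (proj₂ k) (proj₂ h) (proj₂ g)))
  ; identityˡ = λ g → cong₂ _,_ (∘ᵛ-identityˡ (proj₁ g)) (∘ᵛ-identityʳ (proj₂ g))
  ; identityʳ = λ g → cong₂ _,_ (∘ᵛ-identityʳ (proj₁ g)) (∘ᵛ-identityˡ (proj₂ g))
  ; inverseˡ  = λ {g} g∈ → cong₂ _,_ (tabulate-cong (invˡ (∈-perms⁻ g∈))) (tabulate-cong (invˡ (∈-perms⁻ g∈)))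
  ; inverseʳ  = λ {g} g∈ → cong₂ _,_ (tabulate-cong (invʳ (∈-perms⁻ g∈))) (tabulate-cong (invʳ (∈-perms⁻ g∈)))
  ; ⁻¹-anti   = λ g h → refl
  ; _≟ᴳ_      = Product.≡-dec (≡-dec _≟ᶠ_) (≡-dec _≟ᶠ_)
  }
  where
  id-id : ∀ x → lookup (idᵛ {n}) (lookup (idᵛ {n}) x) ≡ x
  id-id x = trans (lookup∘tabulate _ (lookup (idᵛ {n}) x)) (lookup∘tabulate _ x)

-- Boolean tables can be listed, have decidable equality, and are equal as soon as they relate the
-- same points.
Matrix : ℕ → Set
Matrix n = Vec (Vec Bool n) n

module _ {n : ℕ} where

  Rel : Matrix n → Fin n → Fin n → Set
  Rel M x y = T (lookup (lookup M x) y)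

  Rel? : ∀ M → Decidable (Rel M)
  Rel? M x y = T? (lookup (lookup M x) y)

  matrix : {E : Fin n → Fin n → Set} → Decidable E → Matrix n
  matrix E? = tabulate (λ x → tabulate (λ y → does (E? x y)))

  lookup-matrix : ∀ {E} (E? : Decidable E) x y → lookup (lookup (matrix E?) x) y ≡ does (E? x y)
  lookup-matrix E? x y = trans (cong (λ r → lookup r y) (lookup∘tabulate _ x)) (lookup∘tabulate _ y)

  Rel-matrix⁻ : ∀ {E} (E? : Decidable E) {x y} → Rel (matrix E?) x y → E x y
  Rel-matrix⁻ E? {x} {y} r with E? x y | subst T (lookup-matrix E? x y) r
  ... | yes e | _ = e

  Rel-matrix⁺ : ∀ {E} (E? : Decidable E) {x y} → E x y → Rel (matrix E?) x y
  Rel-matrix⁺ E? {x} {y} e = subst T (sym (trans (lookup-matrix E? x y) (dec-true (E? x y) e))) tt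

  Rel-ext : ∀ {M N} → (∀ {x y} → Rel M x y → Rel N x y) → (∀ {x y} → Rel N x y → Rel M x y) → M ≡ N
  Rel-ext f g = lookup-ext λ x → lookup-ext λ y → T-ext _ _ f g
    where
    T-ext : ∀ a b → (T a → T b) → (T b → T a) → a ≡ b
    T-ext true  true  _ _ = refl
    T-ext false false _ _ = refl
    T-ext true  false f _ = ⊥-elim (f tt)
    T-ext false true  _ g = ⊥-elim (g tt)

  isEquivalence? : Decidable₁ (λ M → IsEquivalence (Rel M))
  isEquivalence? M = map′
    (λ (r , s , t) → record { refl = r _ ; sym = s _ _ ; trans = t _ _ _ })
    (λ e → let open IsEquivalence e renaming (refl to r; sym to s; trans to t)
           in (λ _ → r) , (λ _ _ → s) , (λ _ _ _ → t))
    (all? (λ x → Rel? M x x) ×-dec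
     all? (λ x → all? λ y → Rel? M x y →-dec Rel? M y x) ×-dec
     all? (λ x → all? λ y → all? λ z → Rel? M x y →-dec Rel? M y z →-dec Rel? M x z))

  bools : List Bool
  bools = true ∷ false ∷ []

  ∈-bools : ∀ b → b ∈ bools
  ∈-bools true  = here refl
  ∈-bools false = there (here refl)

  equivalences : List (Matrix n)
  equivalences = filter isEquivalence? (choices (λ _ → choices (λ _ → bools)))

  ∈-equivalences⁺ : ∀ {M} → IsEquivalence (Rel M) → M ∈ equivalences
  ∈-equivalences⁺ = ∈-filter⁺ isEquivalence? (∈-choices⁺ _ λ i → ∈-choices⁺ _ λ j → ∈-bools _)

  ∈-equivalences⁻ : ∀ {M} → M ∈ equivalences → IsEquivalence (Rel M)
  ∈-equivalences⁻ M∈ = proj₂ (∈-filter⁻ isEquivalence? {xs = choices (λ _ → choices (λ _ → bools))} M∈)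

  equivalences-unique : Unique equivalences
  equivalences-unique = Unique.filter⁺ isEquivalence?
    (choices-unique _ λ _ → choices-unique _ λ _ → ((λ ()) ∷ []) ∷ [] ∷ [])

  relabelled? : ∀ (g : Perm n) M → Decidable (λ x y → Rel M (app⁻¹ g x) (app⁻¹ g y))
  relabelled? g M x y = Rel? M (app⁻¹ g x) (app⁻¹ g y)

  -- Pulling back along the inverse makes this a left action.
  relabel : Perm n → Matrix n → Matrix n
  relabel g M = matrix (relabelled? g M)

relabelling : ∀ n → Action (symmetricGroup n)
relabelling n = record
  { Point = Matrix n ; points = equivalences ; unique-points = equivalences-unique
  ; _≟ₚ_ = ≡-dec (≡-dec _≟ᵇ_)
  ; _·_ = relabel
  ; ·-closed = λ {g} {M} _ M∈ → let open IsEquivalence (∈-equivalences⁻ M∈) renaming (refl to r; sym to s; trans to t)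
                                    in⁺ = λ {x} {y} → Rel-matrix⁺ (relabelled? g M) {x} {y}
                                    in⁻ = λ {x} {y} → Rel-matrix⁻ (relabelled? g M) {x} {y}
      in ∈-equivalences⁺ (record { refl = in⁺ r ; sym = λ p → in⁺ (s (in⁻ p)) ; trans = λ p q → in⁺ (t (in⁻ p) (in⁻ q)) })
  ; ·-∙ = λ g h M → Rel-ext
      (λ {x} {y} p → Rel-matrix⁺ (relabelled? g (relabel h M)) (Rel-matrix⁺ (relabelled? h M)
         (subst₂ (Rel M) (lookup-∘ᵛ (proj₂ h) (proj₂ g) x) (lookup-∘ᵛ (proj₂ h) (proj₂ g) y)
            (Rel-matrix⁻ (relabelled? (g ∙ h) M) p))))
      (λ {x} {y} p → Rel-matrix⁺ (relabelled? (g ∙ h) M)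
         (subst₂ (Rel M) (sym (lookup-∘ᵛ (proj₂ h) (proj₂ g) x)) (sym (lookup-∘ᵛ (proj₂ h) (proj₂ g) y))
            (Rel-matrix⁻ (relabelled? h M) (Rel-matrix⁻ (relabelled? g (relabel h M)) p))))
  ; ·-ε = λ M → Rel-ext
      (λ {x} {y} p → subst₂ (Rel M) (lookup∘tabulate _ x) (lookup∘tabulate _ y) (Rel-matrix⁻ (relabelled? ε M) p))
      (λ {x} {y} p → Rel-matrix⁺ (relabelled? ε M)
         (subst₂ (Rel M) (sym (lookup∘tabulate _ x)) (sym (lookup∘tabulate _ y)) p))
  }
  where open FiniteGroup (symmetricGroup n)

-- Systems coded as pairs of a permutation and an equivalence relation

module _ {n : ℕ} where

  toPerm : Permutation′ n → Perm n
  toPerm π = tabulate (π ⟨$⟩ʳ_) , tabulate (π ⟨$⟩ˡ_)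

  app-toPerm : ∀ π x → app (toPerm π) x ≡ π ⟨$⟩ʳ x
  app-toPerm π = lookup∘tabulate _

  app⁻¹-toPerm : ∀ π x → app⁻¹ (toPerm π) x ≡ π ⟨$⟩ˡ x
  app⁻¹-toPerm π = lookup∘tabulate _

  toPerm-isPerm : ∀ π → IsPerm (toPerm π)
  toPerm-isPerm π =
    (λ x → trans (app-toPerm π _) (trans (cong (π ⟨$⟩ʳ_) (app⁻¹-toPerm π x)) (⟨$⟩-inverseʳ π))) ,
    (λ x → trans (app⁻¹-toPerm π _) (trans (cong (π ⟨$⟩ˡ_) (app-toPerm π x)) (⟨$⟩-inverseˡ π)))

  fromPerm : ∀ g → IsPerm g → Permutation′ n
  fromPerm g (l , r) = permutation (app g) (app⁻¹ g) l r

  sameMacro? : ∀ (S : MMSystem n) → Decidable (λ x y → m S x ≡ m S y)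
  sameMacro? S x y = m S x ≟ᶠ m S y

  -- An isomorphism may rename macrostates freely, so only the kernel of `m` is kept.
  code : MMSystem n → Perm n × Matrix n
  code S = toPerm (α S) , matrix (sameMacro? S)

  private
    𝔾 : FiniteGroup
    𝔾 = symmetricGroup n

  module Systems = Action (pairing 𝔾 (relabelling n))
  module Conjugacy = Action (conjugation 𝔾)

  app-conjugate : ∀ g a x → app (g Conjugacy.· a) x ≡ app g (app a (app⁻¹ g x))
  app-conjugate g a x = trans (lookup-∘ᵛ (proj₁ g ∘ᵛ proj₁ a) (proj₂ g) x) (lookup-∘ᵛ (proj₁ g) (proj₁ a) _)

  conjugate-isPerm : ∀ {g a} → IsPerm g → IsPerm a → IsPerm (g Conjugacy.· a)
  conjugate-isPerm p q = ∈-perms⁻ (Conjugacy.·-closed (∈-perms⁺ p) (∈-perms⁺ q))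

  code∈points : ∀ S → code S ∈ Systems.points
  code∈points S = ∈-cartesianProduct⁺ (∈-perms⁺ (toPerm-isPerm (α S))) (∈-equivalences⁺ record
    { refl  = Rel-matrix⁺ (sameMacro? S) refl
    ; sym   = λ p → Rel-matrix⁺ (sameMacro? S) (sym (Rel-matrix⁻ (sameMacro? S) p))
    ; trans = λ p q → Rel-matrix⁺ (sameMacro? S) (trans (Rel-matrix⁻ (sameMacro? S) p) (Rel-matrix⁻ (sameMacro? S) q)) })

  iso⇒orbit : ∀ S S′ → Iso S S′ → Systems.Orbit (code S) (code S′)
  iso⇒orbit S S′ (β , β̂ , eα , em) = g , ∈-perms⁺ g-perm , cong₂ _,_
    (perm-ext (conjugate-isPerm g-perm (toPerm-isPerm (α S))) (toPerm-isPerm (α S′)) λ x → begin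
      app (g Conjugacy.· toPerm (α S)) x         ≡⟨ app-conjugate g (toPerm (α S)) x ⟩
      app g (app (toPerm (α S)) (app⁻¹ g x))     ≡⟨ app-toPerm β _ ⟩
      β ⟨$⟩ʳ (app (toPerm (α S)) (app⁻¹ g x))    ≡⟨ cong (β ⟨$⟩ʳ_) (app-toPerm (α S) _) ⟩
      β ⟨$⟩ʳ (α S ⟨$⟩ʳ (app⁻¹ g x))              ≡⟨ sym (eα _) ⟩
      α S′ ⟨$⟩ʳ (β ⟨$⟩ʳ (app⁻¹ g x))             ≡⟨ cong (λ z → α S′ ⟨$⟩ʳ z) (β-undo x) ⟩
      α S′ ⟨$⟩ʳ x                                ≡⟨ sym (app-toPerm (α S′) x) ⟩
      app (toPerm (α S′)) x                      ∎)
    (Rel-ext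
      (λ {x} {y} p → Rel-matrix⁺ (sameMacro? S′) (begin
        m S′ x                      ≡⟨ m-undo x ⟩
        β̂ ⟨$⟩ʳ m S (app⁻¹ g x)      ≡⟨ cong (β̂ ⟨$⟩ʳ_) (Rel-matrix⁻ (sameMacro? S) (Rel-matrix⁻ (relabelled? g (matrix (sameMacro? S))) p)) ⟩
        β̂ ⟨$⟩ʳ m S (app⁻¹ g y)      ≡⟨ sym (m-undo y) ⟩
        m S′ y                      ∎))
      (λ {x} {y} p → Rel-matrix⁺ (relabelled? g (matrix (sameMacro? S))) (Rel-matrix⁺ (sameMacro? S) (begin
        m S (app⁻¹ g x)                         ≡⟨ sym (⟨$⟩-inverseˡ β̂) ⟩
        β̂ ⟨$⟩ˡ (β̂ ⟨$⟩ʳ m S (app⁻¹ g x))         ≡⟨ cong (β̂ ⟨$⟩ˡ_) (trans (sym (m-undo x)) (trans (Rel-matrix⁻ (sameMacro? S′) p) (m-undo y))) ⟩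
        β̂ ⟨$⟩ˡ (β̂ ⟨$⟩ʳ m S (app⁻¹ g y))         ≡⟨ ⟨$⟩-inverseˡ β̂ ⟩
        m S (app⁻¹ g y)                         ∎))))
    where
    open ≡-Reasoning
    g : Perm n
    g = toPerm β
    g-perm : IsPerm g
    g-perm = toPerm-isPerm β
    β-undo : ∀ x → β ⟨$⟩ʳ (app⁻¹ g x) ≡ x
    β-undo x = trans (cong (β ⟨$⟩ʳ_) (app⁻¹-toPerm β x)) (⟨$⟩-inverseʳ β)
    m-undo : ∀ x → m S′ x ≡ β̂ ⟨$⟩ʳ m S (app⁻¹ g x)
    m-undo x = trans (cong (m S′) (sym (β-undo x))) (sym (em (app⁻¹ g x)))

  -- The bijection of macrostates is rebuilt from the preimages that `surj` supplies. The choice of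
  -- preimage is immaterial because `g` carries one kernel to the other, which is what `push` and
  -- `pull` express.
  orbit⇒iso : ∀ S S′ → Systems.Orbit (code S) (code S′) → Iso S S′
  orbit⇒iso S S′ (g , g∈ , e) = fromPerm g g-perm , permutation to from to-from from-to , eα , em
    where
    open ≡-Reasoning
    g-perm : IsPerm g
    g-perm = ∈-perms⁻ g∈
    eα : ∀ x → α S′ ⟨$⟩ʳ app g x ≡ app g (α S ⟨$⟩ʳ x)
    eα x = begin
      α S′ ⟨$⟩ʳ app g x                                   ≡⟨ sym (app-toPerm (α S′) _) ⟩
      app (toPerm (α S′)) (app g x)                       ≡⟨ cong (λ h → app h (app g x)) (sym (cong proj₁ e)) ⟩
      app (g Conjugacy.· toPerm (α S)) (app g x)          ≡⟨ app-conjugate g (toPerm (α S)) _ ⟩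
      app g (app (toPerm (α S)) (app⁻¹ g (app g x)))      ≡⟨ cong (λ z → app g (app (toPerm (α S)) z)) (invˡ g-perm x) ⟩
      app g (app (toPerm (α S)) x)                        ≡⟨ cong (app g) (app-toPerm (α S) x) ⟩
      app g (α S ⟨$⟩ʳ x)                                  ∎
    push : ∀ {x y} → m S x ≡ m S y → m S′ (app g x) ≡ m S′ (app g y)
    push {x} {y} p = Rel-matrix⁻ (sameMacro? S′) (subst (λ M → Rel M (app g x) (app g y)) (cong proj₂ e)
      (Rel-matrix⁺ (relabelled? g (matrix (sameMacro? S))) (Rel-matrix⁺ (sameMacro? S)
        (trans (cong (m S) (invˡ g-perm x)) (trans p (cong (m S) (sym (invˡ g-perm y))))))))
    pull : ∀ {x y} → m S′ x ≡ m S′ y → m S (app⁻¹ g x) ≡ m S (app⁻¹ g y)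
    pull {x} {y} p = Rel-matrix⁻ (sameMacro? S) (Rel-matrix⁻ (relabelled? g (matrix (sameMacro? S)))
      (subst (λ M → Rel M x y) (sym (cong proj₂ e)) (Rel-matrix⁺ (sameMacro? S′) p)))
    to : Fin (a S) → Fin (a S′)
    to y = m S′ (app g (proj₁ (surj S y)))
    from : Fin (a S′) → Fin (a S)
    from y = m S (app⁻¹ g (proj₁ (surj S′ y)))
    to-from : ∀ y → to (from y) ≡ y
    to-from y = trans (push (proj₂ (surj S (from y)))) (trans (cong (m S′) (invʳ g-perm _)) (proj₂ (surj S′ y)))
    from-to : ∀ y → from (to y) ≡ y
    from-to y = trans (pull (proj₂ (surj S′ (to y)))) (trans (cong (m S) (invˡ g-perm _)) (proj₂ (surj S y)))
    em : ∀ x → to (m S x) ≡ m S′ (app g x)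
    em x = push (proj₂ (surj S (m S x)))

  -- Each class is numbered by the position of its representative in a deduplicated list.
  quotient : ∀ {E : Fin n → Fin n → Set} → Decidable E → IsEquivalence E →
    ∃ λ k → Σ (Fin n → Fin k) λ q → (∀ y → ∃ λ x → q x ≡ y) ×
      (∀ {x y} → E x y → q x ≡ q y) × (∀ {x y} → q x ≡ q y → E x y)
  quotient {E} E? eq = length rs , q , q-surj , (λ {x} {y} e → only (Etrans (Esym (q-rep x)) (Etrans e (q-rep y)))) ,
      λ {x} {y} e → Etrans (q-rep x) (Esym (subst (λ i → E y (L.lookup rs i)) (sym e) (q-rep y)))
    where
    open IsEquivalence eq renaming (refl to Erefl; sym to Esym; trans to Etrans)
    rs : List (Fin n)
    rs = deduplicate E? (allFin n)
    rep : ∀ x → ∃ λ r → r ∈ rs × E x r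
    rep x = deduplicate-cover E? eq (allFin n) (∈-allFin x)
    q : Fin n → Fin (length rs)
    q x = index (proj₁ (proj₂ (rep x)))
    q-rep : ∀ x → E x (L.lookup rs (q x))
    q-rep x = subst (E x) (lookup-index (proj₁ (proj₂ (rep x)))) (proj₂ (proj₂ (rep x)))
    only : ∀ {i j} → E (L.lookup rs i) (L.lookup rs j) → i ≡ j
    only {i} {j} e with i ≟ᶠ j
    ... | yes i≡j = i≡j
    ... | no i≢j  = ⊥-elim (AllPairs-lookup (λ ¬e → ¬e ∘ Esym) (deduplicate-apart E? eq (allFin n)) i j i≢j e)
    q-surj : ∀ y → ∃ λ x → q x ≡ y
    q-surj y = L.lookup rs y , only (Esym (q-rep (L.lookup rs y)))

  -- Taking the classes of the relation as macrostates makes the coding onto, so a transversal of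
  -- pairs yields systems.
  decode : ∀ {x} → x ∈ Systems.points → ∃ λ S → code S ≡ x
  decode {g , M} x∈ with ∈-cartesianProduct⁻ perms equivalences x∈
  ... | g∈ , M∈ with quotient (Rel? M) (∈-equivalences⁻ M∈)
  ... | k , q , q-surj , q⁺ , q⁻ = S , cong₂ _,_
      (perm-ext (toPerm-isPerm (α S)) (∈-perms⁻ g∈) (app-toPerm (α S)))
      (Rel-ext (λ p → q⁻ (Rel-matrix⁻ (sameMacro? S) p)) (λ p → Rel-matrix⁺ (sameMacro? S) (q⁺ p)))
    where
    S : MMSystem n
    S = record { a = k ; α = fromPerm g (∈-perms⁻ g∈) ; m = q ; surj = q-surj }

-- Cycle structures

toList-lookup : ∀ {A : Set} {k} (l : Vec A k) → map (lookup l) (allFin k) ≡ toList l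
toList-lookup l = trans (map-tabulate (λ i → i) (lookup l)) (go l)
  where
  go : ∀ {A : Set} {k} (l : Vec A k) → L.tabulate (lookup l) ≡ toList l
  go []      = refl
  go (x ∷ l) = cong (x ∷_) (go l)

-- Coordinates (i , s) on Fin n: the s-th point of the i-th cycle, of length lookup l i.
record Layout (n : ℕ) {k : ℕ} (l : Vec ℕ k) : Set where
  field
    pt       : Fin k → ℕ → Fin n
    positive : ∀ i → 0 < lookup l i
    pt-surj  : ∀ x → ∃₂ λ i s → pt i s ≡ x
    pt-index : ∀ {i j s t} → pt i s ≡ pt j t → i ≡ j
    pt⇒Mod   : ∀ {i s t} → pt i s ≡ pt i t → Mod (lookup l i) s t
    Mod⇒pt   : ∀ {i s t} → Mod (lookup l i) s t → pt i s ≡ pt i t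

  cycle : Fin n → Fin k
  cycle x = proj₁ (pt-surj x)

  place : Fin n → ℕ
  place x = proj₁ (proj₂ (pt-surj x))

  pt-coordinates : ∀ x → pt (cycle x) (place x) ≡ x
  pt-coordinates x = proj₂ (proj₂ (pt-surj x))

  -- The coordinates that `pt-surj` returns for `pt i s` have the same cycle, but a position that is
  -- only congruent to `s`. A function of coordinates therefore descends to points when it respects
  -- that congruence.
  lift : ∀ {A : Set} (f : Fin k → ℕ → A) → (∀ {i s t} → Mod (lookup l i) s t → f i s ≡ f i t) →
         ∀ i s → f (cycle (pt i s)) (place (pt i s)) ≡ f i s
  lift f resp i s with cycle (pt i s) | place (pt i s) | pt-coordinates (pt i s)
  ... | j | t | e with pt-index e
  ... | refl = resp (pt⇒Mod e)

  -- Coordinates become unique once positions are reduced below the cycle length, so the reduced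
  -- pairs match the points one to one.
  sum≡n : sum (toList l) ≡ n
  sum≡n = begin
    sum (toList l)                                ≡⟨ cong sum (sym (toList-lookup l)) ⟩
    ∑ (allFin k) (lookup l)                       ≡⟨ ∑-cong (allFin k) (λ {i} _ → sym (trans (length-map (i ,_) (upTo (lookup l i))) (length-upTo _))) ⟩
    ∑ (allFin k) (length ∘ h)                     ≡⟨ sym (length-concatMap h (allFin k)) ⟩
    length (concatMap h (allFin k))               ≡⟨ bijection⇒length≡ (λ (i , s) x → pt i s ≡ x)
      (Unique-concatMap h (Unique.allFin⁺ k) (λ {i} _ → Unique.map⁺ (cong proj₂) (Unique.upTo⁺ (lookup l i)))
        λ {i} {j} _ _ p q → trans (proj₁ (∈-h i p)) (sym (proj₁ (∈-h j q))))
      (Unique.allFin⁺ n)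
      (λ {(i , s)} _ → pt i s , ∈-allFin _ , refl)
      (λ {x} _ → let i = cycle x
                     instance nz : NonZero (lookup l i)
                              nz = >-nonZero (positive i)
        in (i , place x % lookup l i) ,
           ∈-concatMap⁺ h (lose (∈-allFin i) (∈-map⁺ (i ,_) (∈-upTo⁺ (m%n<n (place x) (lookup l i))))) ,
           trans (Mod⇒pt (Mod-% (lookup l i) (place x))) (pt-coordinates x))
      (λ { {i , s} {j , t} p q refl e → small (∈-H p) (∈-H q) (sym e) })
      (λ _ _ e e′ → trans (sym e) e′) ⟩
    length (allFin n)                             ≡⟨ length-tabulate (λ i → i) ⟩
    n                                             ∎
    where
    open ≡-Reasoning
    h : Fin k → List (Fin k × ℕ)
    h i = map (i ,_) (upTo (lookup l i))
    ∈-h : ∀ i {j s} → (j , s) ∈ h i → i ≡ j × s < lookup l j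
    ∈-h i p with ∈-map⁻ (i ,_) p
    ... | s , s∈ , refl = refl , ∈-upTo⁻ s∈
    ∈-H : ∀ {j s} → (j , s) ∈ concatMap h (allFin k) → s < lookup l j
    ∈-H p = let (i , _ , q) = find (∈-concatMap⁻ h {xs = allFin k} p) in proj₂ (∈-h i q)
    small : ∀ {i j s t} → s < lookup l i → t < lookup l j → pt i s ≡ pt j t → (i , s) ≡ (j , t)
    small s< t< e with pt-index e
    ... | refl = cong (_ ,_) (Mod-< s< t< (pt⇒Mod e))

record Cycles {n k : ℕ} (b : Fin n → Fin n) (l : Vec ℕ k) : Set where
  field
    layout : Layout n l
  open Layout layout public
  field
    pt-suc : ∀ i s → b (pt i s) ≡ pt i (suc s)

module Rotation {n k : ℕ} {l : Vec ℕ k} (Λ : Layout n l) where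
  open Layout Λ

  private
    forward backward : Fin n → Fin n
    forward  x = pt (cycle x) (suc (place x))
    -- One step back is a full turn less one step forward.
    backward x = pt (cycle x) (lookup l (cycle x) ∸ 1 + place x)

    forward-pt : ∀ i s → forward (pt i s) ≡ pt i (suc s)
    forward-pt = lift (λ i s → pt i (suc s)) λ e → Mod⇒pt (Mod-+ (Mod-refl {s = 1}) e)

    backward-pt : ∀ i s → backward (pt i s) ≡ pt i (lookup l i ∸ 1 + s)
    backward-pt = lift (λ i s → pt i (lookup l i ∸ 1 + s)) λ e → Mod⇒pt (Mod-+ Mod-refl e)

    full-turn : ∀ i s → pt i (suc (lookup l i ∸ 1 + s)) ≡ pt i s
    full-turn i s with lookup l i | positive i | (λ {s} {t} → Mod⇒pt {i} {s} {t})
    ... | suc d | _ | M⇒pt = M⇒pt (0 , 1 , trans (+-identityʳ _) (trans (+-comm (suc d) s) (cong (s +_) (sym (*-identityˡ (suc d))))))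

  rotation : ∃ λ g → IsPerm {n} g × Cycles (app g) l
  rotation = toPerm π , toPerm-isPerm π , record
    { layout = Λ ; pt-suc = λ i s → trans (app-toPerm π _) (forward-pt i s) }
    where
    π = permutation forward backward
      (λ x → trans (forward-pt (cycle x) _) (trans (full-turn (cycle x) (place x)) (pt-coordinates x)))
      (λ x → trans (backward-pt (cycle x) _) (trans (cong (pt (cycle x)) (+-suc _ _))
               (trans (full-turn (cycle x) (place x)) (pt-coordinates x))))

-- Consecutive intervals of the prescribed lengths, with positions read as residues. Together with
-- `rotation` this realises every sequence of positive cycle lengths.
standardLayout : ∀ {k} (l : Vec ℕ k) → (∀ i → 0 < lookup l i) → Layout (sum (toList l)) l
standardLayout [] pos = record
  { pt = λ () ; positive = pos ; pt-surj = λ () ; pt-index = λ { {()} } ; pt⇒Mod = λ { {()} } ; Mod⇒pt = λ { {()} } }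
standardLayout (d ∷ l) pos = record
  { pt = pt ; positive = pos ; pt-surj = pt-surj ; pt-index = pt-index ; pt⇒Mod = λ {i} → pt⇒Mod {i} ; Mod⇒pt = λ {i} → Mod⇒pt {i} }
  where
  module Tail = Layout (standardLayout l (pos ∘ suc))
  instance
    nz : NonZero d
    nz = >-nonZero (pos zero)
  N = sum (toList l)
  res : ℕ → Fin d
  res s = fromℕ< (m%n<n s d)
  pt : Fin (suc _) → ℕ → Fin (d + N)
  pt zero    s = res s ↑ˡ N
  pt (suc i) s = d ↑ʳ Tail.pt i s
  left≢right : ∀ {i : Fin d} {j : Fin N} → i ↑ˡ N ≢ d ↑ʳ j
  left≢right {i} {j} e with trans (sym (splitAt-↑ˡ d i N)) (trans (cong (splitAt d) e) (splitAt-↑ʳ d N j))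
  ... | ()
  pt-surj : ∀ x → ∃₂ λ i s → pt i s ≡ x
  pt-surj x with splitAt d x | join-splitAt d N x
  ... | inj₁ y | e = zero , toℕ y , trans (cong (_↑ˡ N) (toℕ-injective (trans (toℕ-fromℕ< _) (m<n⇒m%n≡m (toℕ<n y))))) e
  ... | inj₂ y | e = let (i , s , e′) = Tail.pt-surj y in suc i , s , trans (cong (d ↑ʳ_) e′) e
  pt-index : ∀ {i j s t} → pt i s ≡ pt j t → i ≡ j
  pt-index {zero}  {zero}  e = refl
  pt-index {zero}  {suc j} e = ⊥-elim (left≢right e)
  pt-index {suc i} {zero}  e = ⊥-elim (left≢right (sym e))
  pt-index {suc i} {suc j} e = cong suc (Tail.pt-index (↑ʳ-injective d _ _ e))
  pt⇒Mod : ∀ {i s t} → pt i s ≡ pt i t → Mod (lookup (d ∷ l) i) s t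
  pt⇒Mod {zero}  e = %≡⇒Mod d (trans (sym (toℕ-fromℕ< _)) (trans (cong toℕ (↑ˡ-injective N _ _ e)) (toℕ-fromℕ< _)))
  pt⇒Mod {suc i} e = Tail.pt⇒Mod (↑ʳ-injective d _ _ e)
  Mod⇒pt : ∀ {i s t} → Mod (lookup (d ∷ l) i) s t → pt i s ≡ pt i t
  Mod⇒pt {zero}  e = cong (_↑ˡ N) (fromℕ<-cong _ _ (Mod⇒%≡ d e) _ _)
  Mod⇒pt {suc i} e = cong (d ↑ʳ_) (Tail.Mod⇒pt e)

module _ {n k : ℕ} {l : Vec ℕ k} where

  -- Sending each point to the point with the same coordinates in the other layout intertwines the
  -- permutations, as both raise the position by one.
  sameCycles⇒conjugate : ∀ {g h : Perm n} → IsPerm g → IsPerm h → Cycles (app g) l → Cycles (app h) l →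
                         Conjugacy.Orbit g h
  sameCycles⇒conjugate {g} {h} g-perm h-perm 𝒞 𝒟 = f , ∈-perms⁺ f-perm ,
    perm-ext (conjugate-isPerm f-perm g-perm) h-perm λ x → begin
      app (f Conjugacy.· g) x                 ≡⟨ app-conjugate f g x ⟩
      app f (app g (app⁻¹ f x))               ≡⟨ cong (λ z → app f (app g z)) (app⁻¹-toPerm π x) ⟩
      app f (app g (C.pt (D.cycle x) (D.place x)))   ≡⟨ cong (app f) (C.pt-suc _ _) ⟩
      app f (C.pt (D.cycle x) (suc (D.place x)))     ≡⟨ app-toPerm π _ ⟩
      to (C.pt (D.cycle x) (suc (D.place x)))        ≡⟨ to-pt _ _ ⟩
      D.pt (D.cycle x) (suc (D.place x))             ≡⟨ sym (D.pt-suc _ _) ⟩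
      app h (D.pt (D.cycle x) (D.place x))           ≡⟨ cong (app h) (D.pt-coordinates x) ⟩
      app h x ∎
    where
    open ≡-Reasoning
    module C = Cycles 𝒞
    module D = Cycles 𝒟
    to from : Fin n → Fin n
    to   x = D.pt (C.cycle x) (C.place x)
    from x = C.pt (D.cycle x) (D.place x)
    to-pt : ∀ i s → to (C.pt i s) ≡ D.pt i s
    to-pt = C.lift D.pt D.Mod⇒pt
    from-pt : ∀ i s → from (D.pt i s) ≡ C.pt i s
    from-pt = D.lift C.pt C.Mod⇒pt
    π = permutation to from (λ x → trans (to-pt _ _) (D.pt-coordinates x)) (λ x → trans (from-pt _ _) (C.pt-coordinates x))
    f : Perm n
    f = toPerm π
    f-perm : IsPerm f
    f-perm = toPerm-isPerm π

  -- The layout is transported along the conjugating permutation.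
  Cycles-conjugate : ∀ {g h : Perm n} → Conjugacy.Orbit g h → Cycles (app g) l → Cycles (app h) l
  Cycles-conjugate {g} {h} (f , f∈ , refl) 𝒞 = record
    { layout = record
      { pt       = λ i s → app f (C.pt i s)
      ; positive = C.positive
      ; pt-surj  = λ x → let (i , s , e) = C.pt-surj (app⁻¹ f x) in i , s , trans (cong (app f) e) (invʳ f-perm x)
      ; pt-index = λ e → C.pt-index (f-inj e)
      ; pt⇒Mod   = λ e → C.pt⇒Mod (f-inj e)
      ; Mod⇒pt   = λ e → cong (app f) (C.Mod⇒pt e)
      }
    ; pt-suc = λ i s → trans (app-conjugate f g _) (cong (app f) (trans (cong (app g) (invˡ f-perm _)) (C.pt-suc i s)))
    }
    where
    module C = Cycles 𝒞
    f-perm : IsPerm f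
    f-perm = ∈-perms⁻ f∈
    f-inj : ∀ {x y} → app f x ≡ app f y → x ≡ y
    f-inj e = trans (sym (invˡ f-perm _)) (trans (cong (app⁻¹ f) e) (invˡ f-perm _))

-- Uniqueness and existence of the cycle type

toList-Σ-injective : ∀ {A : Set} {k k′} (l : Vec A k) (l′ : Vec A k′) → toList l ≡ toList l′ →
                     (∃ (Vec A) ∋ (k , l)) ≡ (k′ , l′)
toList-Σ-injective []      []        e = refl
toList-Σ-injective (x ∷ l) (x′ ∷ l′) e with ∷-injectiveˡ e | toList-Σ-injective l l′ (∷-injectiveʳ e)
... | refl | refl = refl

Decreasing : List ℕ → Set
Decreasing = Linked _≥_

module _ {n k k′ : ℕ} {b : Fin n → Fin n} {l : Vec ℕ k} {l′ : Vec ℕ k′} (𝒞 : Cycles b l) (𝒟 : Cycles b l′) where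
  private
    module C = Cycles 𝒞
    module D = Cycles 𝒟

    together : ∀ c {i j s t} → C.pt i s ≡ D.pt j t → C.pt i (c + s) ≡ D.pt j (c + t)
    together zero    e = e
    together (suc c) e = trans (sym (C.pt-suc _ _)) (trans (cong b (together c e)) (D.pt-suc _ _))

    match : Fin k → Fin k′
    match i = D.cycle (C.pt i 0)

    start : Fin k → ℕ
    start i = D.place (C.pt i 0)

    match-pt : ∀ i c → C.pt i (c + 0) ≡ D.pt (match i) (c + start i)
    match-pt i c = together c (sym (D.pt-coordinates (C.pt i 0)))

    -- A full turn in either layout returns to the same point, hence is a multiple of the length in
    -- the other; each length divides the other.
    match-length : ∀ i → lookup l′ (match i) ≡ lookup l i
    match-length i = ∣-antisym
      (Mod-0⇒∣ (Mod-cancel (start i) (subst₂ (Mod _) (sym (+-identityʳ _)) (+-comm (lookup l i) _) (D.pt⇒Mod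
        (trans (sym (match-pt i 0)) (trans (C.Mod⇒pt (Mod-+ (Mod-self (lookup l i)) (Mod-refl {s = 0}))) (match-pt i (lookup l i))))))))
      (Mod-0⇒∣ (subst (Mod _ 0) (+-identityʳ _) (C.pt⇒Mod
        (trans (match-pt i 0) (trans (D.Mod⇒pt (Mod-+ (Mod-self (lookup l′ (match i))) (Mod-refl {s = start i}))) (sym (match-pt i (lookup l′ (match i)))))))))
      where
      Mod-self : ∀ d → Mod d 0 d
      Mod-self d = 1 , 0 , trans (*-identityˡ d) (sym (+-identityʳ d))

    match-injective : ∀ {i j} → match i ≡ match j → i ≡ j
    match-injective {i} {j} e with Mod-negate (D.positive (match i)) (start i)
    -- From the base point of cycle `i`, `w` steps undo `start i` and `start j` more reach the base
    -- point of cycle `j`.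
    ... | w , e′ = C.pt-index (begin
      C.pt i (start j + w + 0)               ≡⟨ match-pt i (start j + w) ⟩
      D.pt (match i) (start j + w + start i) ≡⟨ D.Mod⇒pt (subst₂ (Mod _)
          (trans (cong (start j +_) (+-comm (start i) w)) (sym (+-assoc (start j) w (start i))))
          (+-identityʳ _) (Mod-+ (Mod-refl {s = start j}) e′)) ⟩
      D.pt (match i) (start j)               ≡⟨ cong (λ c → D.pt c (start j)) e ⟩
      D.pt (match j) (start j)               ≡⟨ sym (match-pt j 0) ⟩
      C.pt j 0                               ∎)
      where open ≡-Reasoning

    match-surjective : ∀ j → ∃ λ i → match i ≡ j
    match-surjective j = C.cycle x , D.pt-index (trans (sym (match-pt (C.cycle x) (C.place x)))
        (trans (cong (C.pt (C.cycle x)) (+-identityʳ _)) (C.pt-coordinates x)))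
      where
      x = D.pt j 0

  -- `match` is a bijection of the cycle indices that preserves lengths.
  cycleLengths-↭ : toList l ↭ toList l′
  cycleLengths-↭ = subst₂ _↭_
    (trans (sym (map-∘ (allFin k))) (trans (map-cong match-length (allFin k)) (toList-lookup l)))
    (toList-lookup l′)
    (↭.map⁺ (lookup l′) (∼bag⇒↭ (unique∧set⇒bag (Unique.map⁺ match-injective (Unique.allFin⁺ k)) (Unique.allFin⁺ k′)
      (λ {j} → mk⇔ (λ _ → ∈-allFin _) λ _ → let (i , e) = match-surjective j in
        subst (_∈ map match (allFin k)) e (∈-map⁺ match (∈-allFin i))))))

  -- A sorted list is determined by its multiset of entries.
  cycleLengths-unique : Decreasing (toList l) → Decreasing (toList l′) → (∃ (Vec ℕ) ∋ (k , l)) ≡ (k′ , l′)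
  cycleLengths-unique d d′ = toList-Σ-injective l l′ (Pointwise-≡⇒≡
    (↗↭↗⇒≋ (Flip.totalOrder ≤-totalOrder) d d′ (↭⇒↭ₛ cycleLengths-↭)))

module CycleDecomposition {n : ℕ} {g : Perm n} (g-perm : IsPerm g) where
  private
    b : Fin n → Fin n
    b = app g

    iterate : Fin n → ℕ → Fin n
    iterate x zero    = x
    iterate x (suc s) = b (iterate x s)

    iterate-+ : ∀ x c s → iterate x (c + s) ≡ iterate (iterate x s) c
    iterate-+ x zero    s = refl
    iterate-+ x (suc c) s = cong b (iterate-+ x c s)

    b-injective : ∀ {x y} → b x ≡ b y → x ≡ y
    b-injective e = trans (sym (invˡ g-perm _)) (trans (cong (app⁻¹ g) e) (invˡ g-perm _))

    shift : ∀ x → Shift (λ s t → iterate x s ≡ iterate x t)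
    shift x = record
      { decidable   = λ s t → iterate x s ≟ᶠ iterate x t
      ; equivalence = record { refl = refl ; sym = sym ; trans = trans }
      ; shift⁺      = shift⁺ ; shift⁻ = shift⁻ }
      where
      shift⁺ : ∀ c {s t} → iterate x s ≡ iterate x t → iterate x (c + s) ≡ iterate x (c + t)
      shift⁺ zero    e = e
      shift⁺ (suc c) e = cong b (shift⁺ c e)
      shift⁻ : ∀ c {s t} → iterate x (c + s) ≡ iterate x (c + t) → iterate x s ≡ iterate x t
      shift⁻ zero    e = e
      shift⁻ (suc c) e = shift⁻ c (b-injective e)

    -- Two of the iterates numbered 0 to `n` coincide; by injectivity their common initial steps
    -- cancel, so `x` itself recurs.
    periodic : ∀ x → ∃ (IsPeriod (λ s t → iterate x s ≡ iterate x t))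
    periodic x with pigeonhole (n<1+n n) (λ i → iterate x (toℕ i))
    ... | i , j , i<j , e = period (shift x) (m<n⇒0<n∸m i<j) (Shift.shift⁻ (shift x) (toℕ i) {0}
      (trans (cong (iterate x) (+-identityʳ (toℕ i))) (trans e (cong (iterate x) (sym (m+[n∸m]≡n (<⇒≤ i<j)))))))

    len : Fin n → ℕ
    len x = proj₁ (periodic x)

    len-positive : ∀ x → 0 < len x
    len-positive x = proj₁ (proj₂ (periodic x))

    ≡⇒Mod : ∀ x {s t} → iterate x s ≡ iterate x t → Mod (len x) s t
    ≡⇒Mod x = proj₁ (proj₂ (proj₂ (periodic x)))

    Mod⇒≡ : ∀ x {s t} → Mod (len x) s t → iterate x s ≡ iterate x t
    Mod⇒≡ x = proj₂ (proj₂ (proj₂ (periodic x)))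

    Reach : Fin n → Fin n → Set
    Reach x y = ∃ λ s → iterate x s ≡ y

    -- The iterates repeat with period `len x`, which bounds the search.
    reach? : Decidable Reach
    reach? x y = map′ (λ (s , _ , e) → s , e)
      (λ (s , e) → s % len x , m%n<n s (len x) , trans (Mod⇒≡ x (Mod-% (len x) s)) e)
      (anyUpTo? (λ s → iterate x s ≟ᶠ y) (len x))
      where
      instance
        nz : NonZero (len x)
        nz = >-nonZero (len-positive x)

    reach-sym : ∀ {x y} → Reach x y → Reach y x
    reach-sym {x} (s , refl) with Mod-negate (len-positive x) s
    ... | u , e = u , trans (sym (iterate-+ x u s)) (Mod⇒≡ x (Mod-trans (Mod-reflexive (+-comm u s)) e))

    reach-trans : ∀ {x y z} → Reach x y → Reach y z → Reach x z
    reach-trans {x} (s , refl) (t , refl) = t + s , iterate-+ x t s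

    reach-equivalence : IsEquivalence Reach
    reach-equivalence = record { refl = 0 , refl ; sym = reach-sym ; trans = reach-trans }

    -- Representatives are sorted by decreasing cycle length, the order in which `par` lists parts.
    open Sort (On.decTotalOrder (Flip.decTotalOrder ≤-decTotalOrder) len)

    reps₀ reps : List (Fin n)
    reps₀ = deduplicate reach? (allFin n)
    reps  = sort reps₀

    reps-apart : AllPairs (λ x y → ¬ Reach x y) reps
    reps-apart = ↭ₛ.AllPairs-resp-↭ (setoid (Fin n)) (λ ¬r → ¬r ∘ reach-sym)
      ((λ { refl ¬r → ¬r }) , (λ { refl ¬r → ¬r })) (↭⇒↭ₛ (↭-sym (sort-↭ reps₀)))
      (deduplicate-apart reach? reach-equivalence (allFin n))

    reps-cover : ∀ x → ∃ λ r → r ∈ reps × Reach r x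
    reps-cover x = let (r , r∈ , e) = deduplicate-cover reach? reach-equivalence (allFin n) (∈-allFin x)
                   in r , ↭.∈-resp-↭ (↭-sym (sort-↭ reps₀)) r∈ , reach-sym e

    lookup-fromList : ∀ {A : Set} (xs : List A) i → lookup (fromList xs) i ≡ L.lookup xs i
    lookup-fromList (x ∷ xs) zero    = refl
    lookup-fromList (x ∷ xs) (suc i) = lookup-fromList xs i

    lengths : Vec ℕ (length reps)
    lengths = V.map len (fromList reps)

    rep : Fin (length reps) → Fin n
    rep = L.lookup reps

    lookup-lengths : ∀ i → lookup lengths i ≡ len (rep i)
    lookup-lengths i = trans (lookup-map i len (fromList reps)) (cong len (lookup-fromList reps i))

  cycleDecomposition : ∃₂ λ k (l : Vec ℕ k) → Cycles b l × Decreasing (toList l)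
  cycleDecomposition = length reps , lengths , record
    { layout = record
      { pt       = λ i → iterate (rep i)
      ; positive = λ i → subst (0 <_) (sym (lookup-lengths i)) (len-positive (rep i))
      ; pt-surj  = λ x → let (r , r∈ , s , e) = reps-cover x in
                         index r∈ , s , trans (cong (λ z → iterate z s) (sym (lookup-index r∈))) e
      ; pt-index = λ {i} {j} {s} {t} e → only (reach-trans (s , e) (reach-sym (t , refl)))
      ; pt⇒Mod   = λ {i} e → Mod-modulus (sym (lookup-lengths i)) (≡⇒Mod (rep i) e)
      ; Mod⇒pt   = λ {i} e → Mod⇒≡ (rep i) (Mod-modulus (lookup-lengths i) e)
      }
    ; pt-suc = λ i s → refl
    } , subst Decreasing (sym (trans (toList-map len (fromList reps)) (cong (map len) (toList∘fromList reps))))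
          (Linked.map⁺ (sort-↗ reps₀))
    where
    only : ∀ {i j} → Reach (rep i) (rep j) → i ≡ j
    only {i} {j} e with i ≟ᶠ j
    ... | yes i≡j = i≡j
    ... | no i≢j  = ⊥-elim (AllPairs-lookup (λ ¬r → ¬r ∘ reach-sym) reps-apart i j i≢j e)

-- Conjugacy classes and partitions

T-all⁺ : ∀ {A : Set} {p : A → Bool} xs → (∀ {x} → x ∈ xs → T (p x)) → T (all p xs)
T-all⁺ []       f = tt
T-all⁺ (x ∷ xs) f = Equivalence.from T-∧ (f (here refl) , T-all⁺ xs (f ∘ there))

T-all⁻ : ∀ {A : Set} {p : A → Bool} xs → T (all p xs) → ∀ {x} → x ∈ xs → T (p x)
T-all⁻ (x ∷ xs) t (here refl) = proj₁ (Equivalence.to T-∧ t)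
T-all⁻ (x ∷ xs) t (there x∈)  = T-all⁻ xs (proj₂ (Equivalence.to T-∧ t)) x∈

nonincreasing⁺ : ∀ {xs} → Decreasing xs → T (nonincreasing xs)
nonincreasing⁺ []       = tt
nonincreasing⁺ [-]      = tt
nonincreasing⁺ (p ∷ ps) = Equivalence.from T-∧ (≤⇒≤ᵇ p , nonincreasing⁺ ps)

nonincreasing⁻ : ∀ xs → T (nonincreasing xs) → Decreasing xs
nonincreasing⁻ []           t = []
nonincreasing⁻ (x ∷ [])     t = [-]
nonincreasing⁻ (x ∷ y ∷ xs) t = let (p , ps) = Equivalence.to T-∧ t in ≤ᵇ⇒≤ y x p ∷ nonincreasing⁻ (y ∷ xs) ps

IsPartition : ∀ {k} → ℕ → Vec ℕ k → Set
IsPartition n l = (∀ i → 0 < lookup l i) × Decreasing (toList l) × sum (toList l) ≡ n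

lookup∈toList : ∀ {A : Set} {k} (l : Vec A k) i → lookup l i ∈ toList l
lookup∈toList l i = subst (lookup l i ∈_) (toList-lookup l) (∈-map⁺ (lookup l) (∈-allFin i))

∈-par⁻ : ∀ {k n} {l : Vec ℕ k} → l ∈ par k n → IsPartition n l
∈-par⁻ {k} {n} {l} l∈ with Equivalence.to (T-∧ {all (1 ≤ᵇ_) (toList l)}) (proj₂ (∈-filter⁻ (T? ∘ isPar n ∘ toList) {xs = map (V.map toℕ) (allVecs k (suc n))} l∈))
... | pos , t with Equivalence.to (T-∧ {nonincreasing (toList l)}) t
... | dec , tot = (λ i → ≤ᵇ⇒≤ 1 _ (T-all⁻ {p = 1 ≤ᵇ_} (toList l) pos (lookup∈toList l i))) , nonincreasing⁻ (toList l) dec , ≡ᵇ⇒≡ _ n tot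

entry≤sum : ∀ {k} (l : Vec ℕ k) i → lookup l i ≤ sum (toList l)
entry≤sum (x ∷ l) zero    = m≤m+n x _
entry≤sum (x ∷ l) (suc i) = ≤-trans (entry≤sum l i) (m≤n+m _ x)

-- No part exceeds the total, so the enumeration with entries from 0 to `n` misses no partition.
∈-par⁺ : ∀ {k n} {l : Vec ℕ k} → IsPartition n l → l ∈ par k n
∈-par⁺ {k} {n} {l} (pos , dec , refl) = ∈-filter⁺ (T? ∘ isPar n ∘ toList)
  (subst (_∈ map (V.map toℕ) (allVecs k (suc n))) bounded (∈-map⁺ (V.map toℕ) (∈-allVecs _)))
  (Equivalence.from T-∧ (T-all⁺ {p = 1 ≤ᵇ_} (toList l) (λ x∈ → let (i , _ , e) = ∈-map⁻ (lookup l) (subst (_ ∈_) (sym (toList-lookup l)) x∈)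
      in ≤⇒≤ᵇ (subst (0 <_) (sym e) (pos i)))
    , Equivalence.from T-∧ (nonincreasing⁺ dec , ≡⇒≡ᵇ n n refl)))
  where
  entry : Fin k → Fin (suc n)
  entry i = fromℕ< (s≤s (entry≤sum l i))
  bounded : V.map toℕ (V.tabulate entry) ≡ l
  bounded = lookup-ext λ i → trans (lookup-map i toℕ (V.tabulate entry))
    (trans (cong toℕ (lookup∘tabulate entry i)) (toℕ-fromℕ< (s≤s (entry≤sum l i))))

par-unique : ∀ k n → Unique (par k n)
par-unique k n = Unique.filter⁺ _ (Unique.map⁺ map-toℕ-injective (allVecs-unique k))
  where
  map-toℕ-injective : ∀ {v w : Vec (Fin (suc n)) k} → V.map toℕ v ≡ V.map toℕ w → v ≡ w
  map-toℕ-injective {v} {w} e = lookup-ext λ i → toℕ-injective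
    (trans (sym (lookup-map i toℕ v)) (trans (cong (λ u → lookup u i) e) (lookup-map i toℕ w)))

length≤sum : ∀ {k} (l : Vec ℕ k) → (∀ i → 0 < lookup l i) → k ≤ sum (toList l)
length≤sum []      pos = z≤n
length≤sum (x ∷ l) pos = +-mono-≤ (pos zero) (length≤sum l (pos ∘ suc))

cycleTypes : ℕ → List (∃ (Vec ℕ))
cycleTypes n = concatMap (λ k → map (k ,_) (par k n)) (map suc (upTo n))

module _ {n : ℕ} where

  ∈-cycleTypes⁻ : ∀ {k l} → (k , l) ∈ cycleTypes n → IsPartition n l
  ∈-cycleTypes⁻ p with find (∈-concatMap⁻ (λ k → map (k ,_) (par k n)) {xs = map suc (upTo n)} p)
  ... | k , _ , q with ∈-map⁻ (k ,_) q
  ... | l , l∈ , refl = ∈-par⁻ l∈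

  -- Positive parts number at most `n`, and a partition of `n ≥ 1` has at least one. This is where
  -- `1 ≤ n` enters: the empty permutation has a type without cycles, which the range of `k` leaves
  -- out.
  ∈-cycleTypes⁺ : ∀ {k} {l : Vec ℕ k} → 1 ≤ n → IsPartition n l → (k , l) ∈ cycleTypes n
  ∈-cycleTypes⁺ {zero}  {[]} (s≤s _) (_ , _ , ())
  ∈-cycleTypes⁺ {suc k} {l} 1≤n p@(pos , dec , tot) = ∈-concatMap⁺ _ (lose
    (∈-map⁺ suc (∈-upTo⁺ (subst (suc k ≤_) tot (length≤sum l pos))))
    (∈-map⁺ (suc k ,_) (∈-par⁺ p)))

  cycleTypes-unique : Unique (cycleTypes n)
  cycleTypes-unique = Unique-concatMap _ (Unique.map⁺ suc-injective (Unique.upTo⁺ n))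
    (λ {k} _ → Unique.map⁺ (λ { refl → refl }) (par-unique k n))
    λ {k} {k′} _ _ p q → trans (sym (same k p)) (same k′ q)
    where
    same : ∀ k {κ} → κ ∈ map (k ,_) (par k n) → proj₁ κ ≡ k
    same k p with ∈-map⁻ (k ,_) p
    ... | _ , _ , refl = refl

  HasType : ∃ (Vec ℕ) → Perm n → Set
  HasType (k , l) g = IsPerm g × Cycles (app g) l × Decreasing (toList l)

  realise : ∀ {κ} → κ ∈ cycleTypes n → ∃ (HasType κ)
  realise {k , l} κ∈ with ∈-cycleTypes⁻ κ∈
  ... | pos , dec , refl = let (g , g-perm , 𝒞) = Rotation.rotation (standardLayout l pos) in g , g-perm , 𝒞 , dec

  type-invariant : ∀ {κ κ′ g h} → HasType κ g → HasType κ′ h → Conjugacy.Orbit g h → κ ≡ κ′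
  type-invariant {g = g} {h} (_ , 𝒞 , d) (_ , 𝒟 , d′) o = cycleLengths-unique (Cycles-conjugate {g = g} {h} o 𝒞) 𝒟 d d′

  type-complete : ∀ {κ g h} → HasType κ g → HasType κ h → Conjugacy.Orbit g h
  type-complete (g-perm , 𝒞 , _) (h-perm , 𝒟 , _) = sameCycles⇒conjugate g-perm h-perm 𝒞 𝒟

  type-exists : 1 ≤ n → ∀ {g} → IsPerm g → ∃ λ κ → κ ∈ cycleTypes n × HasType κ g
  type-exists 1≤n g-perm =
    let (k , l , 𝒞 , dec) = CycleDecomposition.cycleDecomposition g-perm
    in (k , l) , ∈-cycleTypes⁺ 1≤n (Cycles.positive 𝒞 , dec , Cycles.sum≡n 𝒞) , g-perm , 𝒞 , dec

  -- One permutation is chosen for each cycle type. Cycle type being a complete invariant of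
  -- conjugacy, distinct types give inconjugate permutations and every permutation is conjugate to
  -- the one chosen for its type.
  conjugacyClasses : 1 ≤ n → ∃ λ cs → Conjugacy.Transversal cs × Pointwise HasType (cycleTypes n) cs
  conjugacyClasses 1≤n = cs , record { ⊆points = ⊆points ; apart = apart ; cover = cover } , pw
    where
    cs : List (Perm n)
    cs = proj₁ (choose (cycleTypes n) realise)
    pw : Pointwise HasType (cycleTypes n) cs
    pw = proj₂ (choose (cycleTypes n) realise)
    ⊆points : ∀ {g} → g ∈ cs → g ∈ perms
    ⊆points g∈ = let (_ , _ , g-perm , _) = Pointwise-∈ʳ pw g∈ in ∈-perms⁺ g-perm
    apart : AllPairs (λ g h → ¬ Conjugacy.Orbit g h) cs
    apart = Pointwise-AllPairs (λ {κ} {κ′} {g} {h} p q κ≢κ′ o → κ≢κ′ (type-invariant {κ} {κ′} {g} {h} p q o)) pw cycleTypes-unique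
    cover : ∀ {g} → g ∈ perms → ∃ λ c → c ∈ cs × Conjugacy.Orbit g c
    cover {g} g∈ =
      let (κ , κ∈ , p) = type-exists 1≤n (∈-perms⁻ g∈)
          (c , c∈ , q) = Pointwise-∈ˡ pw κ∈
      in c , c∈ , type-complete {κ} p q

-- Invariant equivalence relations

module _ {k : ℕ} (f : Vec (Fin k) k) where

  Root : Fin k → Set
  Root r = lookup f r ≡ r

  root? : ∀ r → Dec (Root r)
  root? r = lookup f r ≟ᶠ r

  block : Fin k → List (Fin k)
  block r = filterᵇ (λ i → ⌊ lookup f i ≟ᶠ r ⌋) (allFin k)

  ∈-block⁺ : ∀ {i r} → lookup f i ≡ r → i ∈ block r
  ∈-block⁺ {i} {r} e = ∈-filter⁺ (λ i → T? ⌊ lookup f i ≟ᶠ r ⌋) (∈-allFin i) (fromWitness e)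

  ∈-block⁻ : ∀ {i r} → i ∈ block r → lookup f i ≡ r
  ∈-block⁻ {i} {r} i∈ = toWitness (proj₂ (∈-filter⁻ (λ i → T? ⌊ lookup f i ≟ᶠ r ⌋) {xs = allFin k} i∈))

  block-unique : ∀ r → Unique (block r)
  block-unique r = Unique.filter⁺ _ (Unique.allFin⁺ k)

  record IsSetPartition : Set where
    field
      root≤ : ∀ i → toℕ (lookup f i) ≤ toℕ i
      root-root : ∀ i → Root (lookup f i)

  ∈-SetPar⁺ : IsSetPartition → f ∈ SetPar k
  ∈-SetPar⁺ p = ∈-filter⁺ (T? ∘ isSetPar) (∈-allVecs f)
    (T-all⁺ (allFin k) λ {i} _ → Equivalence.from T-∧ (≤⇒≤ᵇ (root≤ i) , fromWitness (root-root i)))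
    where open IsSetPartition p

  ∈-SetPar⁻ : f ∈ SetPar k → IsSetPartition
  ∈-SetPar⁻ f∈ = record { root≤ = λ i → ≤ᵇ⇒≤ _ _ (proj₁ (both i)) ; root-root = λ i → toWitness (proj₂ (both i)) }
    where
    both : ∀ i → T (toℕ (lookup f i) ≤ᵇ toℕ i) × T ⌊ lookup f (lookup f i) ≟ᶠ lookup f i ⌋
    both i = Equivalence.to T-∧ (T-all⁻ (allFin k) (proj₂ (∈-filter⁻ (T? ∘ isSetPar) {xs = allVecs k k} f∈)) (∈-allFin i))

SetPar-unique : ∀ k → Unique (SetPar k)
SetPar-unique k = Unique.filter⁺ _ (allVecs-unique k)

∣-gcds⁺ : ∀ {d} xs → (∀ {x} → x ∈ xs → d ∣ x) → d ∣ foldr gcd 0 xs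
∣-gcds⁺ []       f = _ ∣0
∣-gcds⁺ (x ∷ xs) f = gcd-greatest (f (here refl)) (∣-gcds⁺ xs (f ∘ there))

gcds-∣ : ∀ xs {x} → x ∈ xs → foldr gcd 0 xs ∣ x
gcds-∣ (x ∷ xs) (here refl) = gcd[m,n]∣m x _
gcds-∣ (x ∷ xs) (there x∈)  = ∣-trans (gcd[m,n]∣n x _) (gcds-∣ xs x∈)

divisors : ℕ → List ℕ
divisors g = filter (_∣? g) (map suc (upTo g))

∈-divisors⁺ : ∀ {d g} → 0 < d → 0 < g → d ∣ g → d ∈ divisors g
∈-divisors⁺ {suc d} {g} _ 0<g d∣g = ∈-filter⁺ (_∣? g) (∈-map⁺ suc (∈-upTo⁺ (∣⇒≤ {{>-nonZero 0<g}} d∣g))) d∣g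

∈-divisors⁻ : ∀ {d g} → d ∈ divisors g → 0 < d × d ∣ g
∈-divisors⁻ {d} {g} d∈ with ∈-filter⁻ (_∣? g) {xs = map suc (upTo g)} d∈
... | p , d∣g with ∈-map⁻ suc p
... | _ , _ , refl = s≤s z≤n , d∣g

∣-positive : ∀ {d g} → 0 < g → d ∣ g → 0 < d
∣-positive {suc d} _ _ = s≤s z≤n
∣-positive {zero} {suc g} _ (divides q e) with trans e (*-zeroʳ q)
... | ()

ifDec : ∀ {P : Set} {A : Set} → Dec P → A → A → A
ifDec (yes _) x y = x
ifDec (no _)  x y = y

ifDec-yes : ∀ {P A : Set} (d : Dec P) {x y : A} → P → ifDec d x y ≡ x
ifDec-yes (yes _) p = refl
ifDec-yes (no ¬p) p = ⊥-elim (¬p p)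

ifDec-no : ∀ {P A : Set} (d : Dec P) {x y : A} → ¬ P → ifDec d x y ≡ y
ifDec-no (yes p) ¬p = ⊥-elim (¬p p)
ifDec-no (no _)  ¬p = refl

∏-single : ∀ {A : Set} {f : A → ℕ} {xs x₀} → Unique xs → x₀ ∈ xs → (∀ {x} → x ∈ xs → x ≢ x₀ → f x ≡ 1) → ∏ xs f ≡ f x₀
∏-single {f = f} {x ∷ xs} (x∉ ∷ _) (here refl) e =
  trans (cong (f x *_) (ones xs λ y∈ → e (there y∈) (All.lookup x∉ y∈ ∘ sym))) (*-identityʳ _)
  where
  ones : ∀ ys → (∀ {y} → y ∈ ys → f y ≡ 1) → ∏ ys f ≡ 1
  ones []       _ = refl
  ones (y ∷ ys) e = cong₂ _*_ (e (here refl)) (ones ys (e ∘ there))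
∏-single {xs = x ∷ xs} (x∉ ∷ u) (there x₀∈) e =
  trans (cong₂ _*_ (e (here refl) (All.lookup x∉ x₀∈)) (∏-single u x₀∈ (e ∘ there))) (*-identityˡ _)

∏-power : ∀ {A : Set} {f : A → ℕ} {d xs x₀} → Unique xs → x₀ ∈ xs → f x₀ ≡ 1 → (∀ {x} → x ≢ x₀ → f x ≡ d) →
          ∏ xs f ≡ d ^ (length xs ∸ 1)
∏-power {f = f} {d} {x ∷ xs} (x∉ ∷ _) (here refl) e e′ =
  trans (cong₂ _*_ e (const xs λ y∈ → e′ (All.lookup x∉ y∈ ∘ sym))) (*-identityˡ _)
  where
  const : ∀ ys → (∀ {y} → y ∈ ys → f y ≡ d) → ∏ ys f ≡ d ^ length ys
  const []       _ = refl
  const (y ∷ ys) e = cong₂ _*_ (e (here refl)) (const ys (e ∘ there))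
∏-power {f = f} {d} {x ∷ y ∷ xs} (x∉ ∷ u) (there x₀∈) e e′ =
  cong₂ _*_ (e′ (All.lookup x∉ x₀∈)) (∏-power u x₀∈ e e′)

-- Counting the periods and offsets on a set partition

module _ {k : ℕ} (l : Vec ℕ k) (f : Vec (Fin k) k) where

  private
    blockGcd : Fin k → ℕ
    blockGcd r = foldr gcd 0 (map (lookup l) (block f r))

  -- A vector D of periods records the period of each block at the block's root, and 0 elsewhere.
  periodChoices : Fin k → List ℕ
  periodChoices r = ifDec (root? f r) (divisors (blockGcd r)) [ 0 ]

  -- The root is the base from which its block is measured, so its offset is pinned to 0; this lost
  -- freedom lowers the exponent in `σ` by one.
  offsetChoices : Vec ℕ k → Fin k → List ℕ
  offsetChoices D i = ifDec (root? f i) [ 0 ] (upTo (lookup D (lookup f i)))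

  labellings : List (Vec ℕ k × Vec ℕ k)
  labellings = concatMap (λ D → map (D ,_) (choices (offsetChoices D))) (choices periodChoices)

  labellings-unique : Unique labellings
  labellings-unique = Unique-concatMap _ (choices-unique periodChoices periods!)
    (λ {D} _ → Unique.map⁺ (cong proj₂) (choices-unique (offsetChoices D) (offsets! D)))
    λ {D} {D′} _ _ p q → trans (sym (same D p)) (same D′ q)
    where
    periods! : ∀ r → Unique (periodChoices r)
    periods! r with root? f r
    ... | yes _ = Unique.filter⁺ (_∣? blockGcd r) (Unique.map⁺ suc-injective (Unique.upTo⁺ (blockGcd r)))
    ... | no _  = [] ∷ []
    offsets! : ∀ D i → Unique (offsetChoices D i)
    offsets! D i with root? f i
    ... | yes _ = [] ∷ []
    ... | no _  = Unique.upTo⁺ _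
    same : ∀ D {x} → x ∈ map (D ,_) (choices (offsetChoices D)) → proj₁ x ≡ D
    same D p with ∈-map⁻ (D ,_) p
    ... | _ , _ , refl = refl

  private
    weight : Fin k → ℕ → ℕ
    weight r d = ifDec (root? f r) (d ^ (length (block f r) ∸ 1)) 1

  -- The product is regrouped by blocks. A square table has the factor of cycle `i` in the column of
  -- its root and 1 elsewhere: the row products are the numbers of offsets, the column products the
  -- powers belonging to the blocks.
  ∏-offsets : IsSetPartition f → ∀ D → ∏ᶠ k (length ∘ offsetChoices D) ≡ ∏ᶠ k (λ r → weight r (lookup D r))
  ∏-offsets p D = begin
    ∏ᶠ k (length ∘ offsetChoices D)                             ≡⟨ sym (∏-allFin k _) ⟩
    ∏ (allFin k) (length ∘ offsetChoices D)                     ≡⟨ ∏-cong (allFin k) (λ i → sym (row i)) ⟩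
    ∏ (allFin k) (λ i → ∏ (allFin k) (u i))                     ≡⟨ ∏-swap u (allFin k) (allFin k) ⟩
    ∏ (allFin k) (λ r → ∏ (allFin k) (λ i → u i r))             ≡⟨ ∏-cong (allFin k) column ⟩
    ∏ (allFin k) (λ r → weight r (lookup D r))                  ≡⟨ ∏-allFin k _ ⟩
    ∏ᶠ k (λ r → weight r (lookup D r))                          ∎
    where
    open ≡-Reasoning
    open IsSetPartition p
    u : Fin k → Fin k → ℕ
    u i r = ifDec (lookup f i ≟ᶠ r) (ifDec (i ≟ᶠ r) 1 (lookup D r)) 1
    row : ∀ i → ∏ (allFin k) (u i) ≡ length (offsetChoices D i)
    row i = trans (∏-single (Unique.allFin⁺ k) (∈-allFin (lookup f i)) λ {r} _ r≢ → ifDec-no (lookup f i ≟ᶠ r) (r≢ ∘ sym))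
      (trans (ifDec-yes (lookup f i ≟ᶠ lookup f i) refl) diagonal)
      where
      diagonal : ifDec (i ≟ᶠ lookup f i) 1 (lookup D (lookup f i)) ≡ length (offsetChoices D i)
      diagonal with root? f i
      ... | yes e = ifDec-yes (i ≟ᶠ lookup f i) (sym e)
      ... | no ¬e = trans (ifDec-no (i ≟ᶠ lookup f i) (¬e ∘ sym)) (sym (length-upTo _))
    column : ∀ r → ∏ (allFin k) (λ i → u i r) ≡ weight r (lookup D r)
    column r with root? f r
    ... | yes e = trans (sym (∏-filter (λ i → T? ⌊ lookup f i ≟ᶠ r ⌋) (λ i → ifDec (i ≟ᶠ r) 1 (lookup D r)) (λ i → u i r) (allFin k)
                    (λ {i} t → ifDec-yes (lookup f i ≟ᶠ r) (toWitness t))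
                    (λ {i} ¬t → ifDec-no (lookup f i ≟ᶠ r) (¬t ∘ fromWitness))))
                  (∏-power (block-unique f r) (∈-block⁺ f e) (ifDec-yes (r ≟ᶠ r) refl) λ {i} → ifDec-no (i ≟ᶠ r))
    ... | no ¬e = trans (∏-cong (allFin k) (λ i → ifDec-no (lookup f i ≟ᶠ r) λ { refl → ¬e (root-root i) })) (∏-one (allFin k))

  -- With the periods fixed, each block contributes a power of its own period only. The sum over all
  -- families of periods then factors over the roots, and each factor is a sum over the divisors of
  -- the gcd of the block.
  length-labellings : IsSetPartition f → length labellings ≡ ∏ (blocks f) (λ c → σ (map (lookup l) c))
  length-labellings p = begin
    length labellings                                                ≡⟨ length-concatMap _ (choices periodChoices) ⟩
    ∑ (choices periodChoices) (λ D → length (map (D ,_) (choices (offsetChoices D))))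
      ≡⟨ ∑-cong (choices periodChoices) (λ {D} _ → trans (length-map (D ,_) (choices (offsetChoices D)))
           (trans (length-choices (offsetChoices D)) (∏-offsets p D))) ⟩
    ∑ (choices periodChoices) (λ D → ∏ᶠ k (λ r → weight r (lookup D r)))   ≡⟨ ∑-choices periodChoices weight ⟩
    ∏ᶠ k (λ r → ∑ (periodChoices r) (weight r))                            ≡⟨ sym (∏-allFin k _) ⟩
    ∏ (allFin k) (λ r → ∑ (periodChoices r) (weight r))                    ≡⟨ sym (∏-filter (λ r → T? ⌊ root? f r ⌋)
         (λ r → σ (map (lookup l) (block f r))) _ (allFin k) (λ {r} → atRoot r ∘ toWitness) (λ {r} ¬t → elsewhere r (¬t ∘ fromWitness))) ⟩
    ∏ (filterᵇ (λ r → ⌊ root? f r ⌋) (allFin k)) (λ r → σ (map (lookup l) (block f r)))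
      ≡⟨ cong product (map-∘ (filterᵇ (λ r → ⌊ root? f r ⌋) (allFin k))) ⟩
    ∏ (blocks f) (λ c → σ (map (lookup l) c)) ∎
    where
    open ≡-Reasoning
    atRoot : ∀ r → Root f r → ∑ (periodChoices r) (weight r) ≡ σ (map (lookup l) (block f r))
    atRoot r e with root? f r
    ... | yes _ = cong (λ len → ∑ (divisors (blockGcd r)) (λ d → d ^ (len ∸ 1))) (sym (length-map (lookup l) (block f r)))
    ... | no ¬e = ⊥-elim (¬e e)
    elsewhere : ∀ r → ¬ Root f r → ∑ (periodChoices r) (weight r) ≡ 1
    elsewhere r ¬e with root? f r
    ... | yes e = ⊥-elim (¬e e)
    ... | no _  = refl

-- Membership in `labellings` restated for single cycles: dividing the gcd of a block becomes
-- dividing every cycle length in it.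
record IsLabelling {k : ℕ} (l : Vec ℕ k) (f : Vec (Fin k) k) (D o : Vec ℕ k) : Set where
  field
    period-positive : ∀ i → 0 < lookup D (lookup f i)
    period-∣        : ∀ i → lookup D (lookup f i) ∣ lookup l i
    period-0        : ∀ r → ¬ Root f r → lookup D r ≡ 0
    offset-0        : ∀ r → Root f r → lookup o r ≡ 0
    offset-<        : ∀ i → lookup o i < lookup D (lookup f i)

module _ {k : ℕ} {l : Vec ℕ k} (positive : ∀ i → 0 < lookup l i) {f : Vec (Fin k) k} (p : IsSetPartition f) where
  open IsSetPartition p

  ∈-labellings⁺ : ∀ {D o} → IsLabelling l f D o → (D , o) ∈ labellings l f
  ∈-labellings⁺ {D} {o} L = ∈-concatMap⁺ _ (lose (∈-choices⁺ D period∈) (∈-map⁺ (D ,_) (∈-choices⁺ o offset∈)))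
    where
    open IsLabelling L
    period∈ : ∀ r → lookup D r ∈ periodChoices l f r
    period∈ r with root? f r
    ... | no ¬e = here (period-0 r ¬e)
    ... | yes e = ∈-divisors⁺ (subst (λ q → 0 < lookup D q) e (period-positive r))
      (∣-positive (positive r) (gcds-∣ (map (lookup l) (block f r)) (∈-map⁺ (lookup l) (∈-block⁺ f e))))
      (∣-gcds⁺ _ λ x∈ → let (i , i∈ , x≡) = ∈-map⁻ (lookup l) x∈ in
        subst₂ _∣_ (cong (lookup D) (∈-block⁻ f i∈)) (sym x≡) (period-∣ i))
    offset∈ : ∀ i → lookup o i ∈ offsetChoices l f D i
    offset∈ i with root? f i
    ... | yes e = here (offset-0 i e)
    ... | no _  = ∈-upTo⁺ (offset-< i)

  ∈-labellings⁻ : ∀ {D o} → (D , o) ∈ labellings l f → IsLabelling l f D o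
  ∈-labellings⁻ {D} {o} q with find (∈-concatMap⁻ (λ D → map (D ,_) (choices (offsetChoices l f D))) {xs = choices (periodChoices l f)} q)
  ... | D , D∈ , q′ with ∈-map⁻ (D ,_) q′
  ... | o , o∈ , refl = record
    { period-positive = λ i → proj₁ (atRoot (lookup f i) (root-root i))
    ; period-∣        = λ i → ∣-trans (proj₂ (atRoot (lookup f i) (root-root i)))
                                (gcds-∣ _ (∈-map⁺ (lookup l) (∈-block⁺ f refl)))
    ; period-0        = period-0
    ; offset-0        = offset-0
    ; offset-<        = offset-<
    }
    where
    atRoot : ∀ r → Root f r → 0 < lookup D r × lookup D r ∣ foldr gcd 0 (map (lookup l) (block f r))
    atRoot r e with root? f r | ∈-choices⁻ (periodChoices l f) D∈ r
    ... | yes _ | d∈ = ∈-divisors⁻ d∈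
    ... | no ¬e | _  = ⊥-elim (¬e e)
    period-0 : ∀ r → ¬ Root f r → lookup D r ≡ 0
    period-0 r ¬e with root? f r | ∈-choices⁻ (periodChoices l f) D∈ r
    ... | yes e | _ = ⊥-elim (¬e e)
    ... | no _  | here d≡0 = d≡0
    offset-0 : ∀ r → Root f r → lookup o r ≡ 0
    offset-0 r e with root? f r | ∈-choices⁻ (offsetChoices l f D) o∈ r
    ... | yes _ | here o≡0 = o≡0
    ... | no ¬e | _ = ⊥-elim (¬e e)
    offset-< : ∀ i → lookup o i < lookup D (lookup f i)
    offset-< i with root? f i | ∈-choices⁻ (offsetChoices l f D) o∈ i
    ... | yes e | here o≡0 = subst (_< _) (sym o≡0) (proj₁ (atRoot (lookup f i) (root-root i)))
    ... | no _  | o<       = ∈-upTo⁻ o<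

module _ {n : ℕ} {g : Perm n} (g-perm : IsPerm g) {M : Matrix n} where

  Invariant : Set
  Invariant = ∀ {x y} → (Rel M x y → Rel M (app g x) (app g y)) × (Rel M (app g x) (app g y) → Rel M x y)

  fixed⇒invariant : relabel g M ≡ M → Invariant
  fixed⇒invariant e {x} {y} =
    (λ r → subst (λ N → Rel N (app g x) (app g y)) e (Rel-matrix⁺ (relabelled? g M)
             (subst₂ (Rel M) (sym (invˡ g-perm x)) (sym (invˡ g-perm y)) r))) ,
    (λ r → subst₂ (Rel M) (invˡ g-perm x) (invˡ g-perm y) (Rel-matrix⁻ (relabelled? g M)
             (subst (λ N → Rel N (app g x) (app g y)) (sym e) r)))

  invariant⇒fixed : Invariant → relabel g M ≡ M
  invariant⇒fixed inv = Rel-ext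
    (λ {x} {y} r → subst₂ (Rel M) (invʳ g-perm x) (invʳ g-perm y) (proj₁ inv (Rel-matrix⁻ (relabelled? g M) r)))
    (λ {x} {y} r → Rel-matrix⁺ (relabelled? g M) (proj₂ inv (subst₂ (Rel M) (sym (invʳ g-perm x)) (sym (invʳ g-perm y)) r)))

-- Invariant relations correspond to labelled set partitions

Triple : ℕ → Set
Triple k = Vec (Fin k) k × Vec ℕ k × Vec ℕ k

module _ {n k : ℕ} {g : Perm n} (g-perm : IsPerm g) {l : Vec ℕ k} (𝒞 : Cycles (app g) l) where
  open Cycles 𝒞

  triples : List (Triple k)
  triples = concatMap (λ f → map (f ,_) (labellings l f)) (SetPar k)

  record IsTriple (τ : Triple k) : Set where
    constructor _,_
    field
      isSetPartition : IsSetPartition (proj₁ τ)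
      isLabelling    : IsLabelling l (proj₁ τ) (proj₁ (proj₂ τ)) (proj₂ (proj₂ τ))

  ∈-triples⁺ : ∀ {τ} → IsTriple τ → τ ∈ triples
  ∈-triples⁺ {f , D , o} (p , q) = ∈-concatMap⁺ _ (lose (∈-SetPar⁺ f p) (∈-map⁺ (f ,_) (∈-labellings⁺ positive p q)))

  ∈-triples⁻ : ∀ {τ} → τ ∈ triples → IsTriple τ
  ∈-triples⁻ τ∈ with find (∈-concatMap⁻ (λ f → map (f ,_) (labellings l f)) {xs = SetPar k} τ∈)
  ... | f , f∈ , q with ∈-map⁻ (f ,_) q
  ... | _ , q∈ , refl = ∈-SetPar⁻ f f∈ , ∈-labellings⁻ positive (∈-SetPar⁻ f f∈) q∈

  triples-unique : Unique triples
  triples-unique = Unique-concatMap _ (SetPar-unique k)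
    (λ {f} _ → Unique.map⁺ (cong proj₂) (labellings-unique l f))
    λ {f} {f′} _ _ p q → trans (sym (same f p)) (same f′ q)
    where
    same : ∀ f {τ} → τ ∈ map (f ,_) (labellings l f) → proj₁ τ ≡ f
    same f p with ∈-map⁻ (f ,_) p
    ... | _ , _ , refl = refl

  -- The point s of cycle i lies s − oᵢ steps after the block's base point, so
  -- two points of one block are equivalent when these positions agree modulo
  -- the period; the offsets are moved across to avoid subtraction.
  Aligned : Triple k → Fin k → ℕ → Fin k → ℕ → Set
  Aligned (f , D , o) i s j t =
    lookup f i ≡ lookup f j × Mod (lookup D (lookup f i)) (lookup o j + s) (lookup o i + t)

  -- The matching relation used for counting; on normalised triples each side determines the other.
  record Describes (M : Matrix n) (τ : Triple k) : Set where
    field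
      rel⇒aligned : ∀ {i s j t} → Rel M (pt i s) (pt j t) → Aligned τ i s j t
      aligned⇒rel : ∀ {i s j t} → Aligned τ i s j t → Rel M (pt i s) (pt j t)

  describes-injectiveˡ : ∀ {M M′ τ} → Describes M τ → Describes M′ τ → M ≡ M′
  describes-injectiveˡ d d′ = Rel-ext (transfer d d′) (transfer d′ d)
    where
    transfer : ∀ {M M′ τ} → Describes M τ → Describes M′ τ → ∀ {x y} → Rel M x y → Rel M′ x y
    transfer {M} {M′} d d′ {x} {y} r = subst₂ (Rel M′) (pt-coordinates x) (pt-coordinates y)
      (Describes.aligned⇒rel d′ (Describes.rel⇒aligned d
        (subst₂ (Rel M) (sym (pt-coordinates x)) (sym (pt-coordinates y)) r)))

  -- All three components can be recovered from the relation: the root as the least cycle of the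
  -- block, the period from the root cycle alone, and the offset as the only position below the
  -- period that is equivalent to the base point.
  describes-injectiveʳ : ∀ {M τ τ′} → IsTriple τ → IsTriple τ′ → Describes M τ → Describes M τ′ → τ ≡ τ′
  describes-injectiveʳ {M} {τ@(f , D , o)} {τ′@(f′ , D′ , o′)} (p , q) (p′ , q′) d d′ = eq f≡f′
    where
    module S = IsSetPartition p
    module Q = IsLabelling q
    module Q′ = IsLabelling q′
    across : ∀ {i s j t} → Aligned τ i s j t → Aligned τ′ i s j t
    across a = Describes.rel⇒aligned d′ (Describes.aligned⇒rel d a)
    across′ : ∀ {i s j t} → Aligned τ′ i s j t → Aligned τ i s j t
    across′ a = Describes.rel⇒aligned d (Describes.aligned⇒rel d′ a)
    roots≤ : ∀ {τ τ′} → IsTriple τ → IsTriple τ′ → (∀ {i s j t} → Aligned τ i s j t → Aligned τ′ i s j t) →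
             ∀ i → toℕ (lookup (proj₁ τ′) i) ≤ toℕ (lookup (proj₁ τ) i)
    -- In the first triple cycle `i` and its root are aligned when each stands at its own offset. In
    -- the second they therefore share a root, which cannot exceed the root from the first.
    roots≤ {f , D , o} {f′ , _} (p , q) (p′ , q′) across i = subst (λ r → toℕ r ≤ toℕ (lookup f i))
      (proj₁ (across {lookup f i} {lookup o (lookup f i)} {i} {lookup o i}
        (IsSetPartition.root-root p i , Mod-reflexive (+-comm (lookup o i) _))))
      (IsSetPartition.root≤ p′ (lookup f i))
    f≡f′ : f ≡ f′
    f≡f′ = lookup-ext λ i → toℕ-injective
      (≤-antisym (roots≤ {τ′} {τ} (p′ , q′) (p , q) across′ i) (roots≤ {τ} {τ′} (p , q) (p′ , q′) across i))
    eq : f ≡ f′ → τ ≡ τ′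
    eq refl = cong₂ (λ D o → f , D , o) (lookup-ext D≡) (lookup-ext o≡)
      where
      -- Positions 0 and `lookup D r` of the root cycle are equivalent, so their difference is a
      -- multiple of the other period.
      D∣ : ∀ {D D′ o o′} → (∀ {i s j t} → Aligned (f , D , o) i s j t → Aligned (f , D′ , o′) i s j t) →
           ∀ r → Root f r → lookup D′ r ∣ lookup D r
      D∣ {D} {D′} {o} {o′} across r e = Mod-0⇒∣ (Mod-cancel (lookup o′ r)
        (Mod-modulus (cong (lookup D′) e) (proj₂ (across {r} {0} {r} {lookup D r}
          (refl , Mod-+ Mod-refl (Mod-modulus (cong (lookup D) (sym e)) (∣⇒Mod-0 (divides 1 (sym (*-identityˡ _))))))))))
      D≡ : ∀ r → lookup D r ≡ lookup D′ r
      D≡ r with root? f r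
      ... | yes e = ∣-antisym (D∣ {D′} {D} {o′} {o} across′ r e) (D∣ {D} {D′} {o} {o′} across r e)
      ... | no ¬e = trans (Q.period-0 r ¬e) (sym (Q′.period-0 r ¬e))
      o≡ : ∀ i → lookup o i ≡ lookup o′ i
      -- The base point of the root cycle is aligned with position `lookup o i` of cycle `i`. Read
      -- in the second triple this makes the two offsets congruent, and both lie below the period.
      o≡ i = sym (Mod-< (Q′.offset-< i) (subst (lookup o i <_) (D≡ (lookup f i)) (Q.offset-< i))
        (subst₂ (Mod _) (+-identityʳ _) (cong (_+ lookup o i) (Q′.offset-0 r (S.root-root i)))
          (Mod-modulus (cong (lookup D′) (S.root-root i)) (proj₂ (across {r} {0} {i} {lookup o i}
            (S.root-root i , Mod-reflexive (trans (+-identityʳ _) (cong (_+ lookup o i) (sym (Q.offset-0 r (S.root-root i)))))))))))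
        where
        r = lookup f i

  aligned? : ∀ τ i s j t → Dec (Aligned τ i s j t)
  aligned? (f , D , o) i s j t = (lookup f i ≟ᶠ lookup f j) ×-dec Mod? (lookup D (lookup f i)) _ _

  module FromTriple {τ : Triple k} (isTriple : IsTriple τ) where
    private
      f = proj₁ τ
      D = proj₁ (proj₂ τ)
      o = proj₂ (proj₂ τ)
    open IsTriple isTriple
    open IsLabelling isLabelling

    aligned-refl : ∀ {i s} → Aligned τ i s i s
    aligned-refl = refl , Mod-refl

    aligned-sym : ∀ {i s j t} → Aligned τ i s j t → Aligned τ j t i s
    aligned-sym (e , a) = sym e , Mod-modulus (cong (lookup D) e) (Mod-sym a)

    -- The two congruences are added and the terms of the middle point cancelled.
    aligned-trans : ∀ {i s j t h u} → Aligned τ i s j t → Aligned τ j t h u → Aligned τ i s h u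
    aligned-trans {i} {s} {j} {t} {h} {u} (e , a) (e′ , a′) = trans e e′ ,
      Mod-cancel (lookup o j + t) (subst₂ (Mod _) (swap₁ (lookup o j) s (lookup o h) t) (swap₂ (lookup o i) t (lookup o j) u)
        (Mod-+ a (Mod-modulus (cong (lookup D) (sym e)) a′)))
      where
      swap₁ : ∀ oj s oh t → oj + s + (oh + t) ≡ oj + t + (oh + s)
      swap₁ = solve-∀
      swap₂ : ∀ oi t oj u → oi + t + (oj + u) ≡ oj + t + (oi + u)
      swap₂ = solve-∀

    -- Since the period divides the cycle length, a full turn does not affect alignment; the
    -- relation thus depends on points and not on their coordinates.
    aligned-pt : ∀ {i s i′ s′} → pt i s ≡ pt i′ s′ → Aligned τ i s i′ s′
    aligned-pt {i} e with pt-index e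
    ... | refl = refl , Mod-+ Mod-refl (Mod-∣ (period-∣ i) (pt⇒Mod e))

    private
      E : Fin n → Fin n → Set
      E x y = Aligned τ (cycle x) (place x) (cycle y) (place y)
      E? : Decidable E
      E? x y = aligned? τ _ _ _ _
      M : Matrix n
      M = matrix E?
      rel⇒aligned : ∀ {i s j t} → Rel M (pt i s) (pt j t) → Aligned τ i s j t
      rel⇒aligned {i} {s} {j} {t} r = aligned-trans (aligned-pt (sym (pt-coordinates (pt i s))))
        (aligned-trans (Rel-matrix⁻ E? r) (aligned-pt (pt-coordinates (pt j t))))
      aligned⇒rel : ∀ {i s j t} → Aligned τ i s j t → Rel M (pt i s) (pt j t)
      aligned⇒rel {i} {s} {j} {t} a = Rel-matrix⁺ E? (aligned-trans (aligned-pt (pt-coordinates (pt i s)))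
        (aligned-trans a (aligned-pt (sym (pt-coordinates (pt j t))))))
      aligned-suc : ∀ {i s j t} → Aligned τ i s j t → Aligned τ i (suc s) j (suc t)
      aligned-suc (e , a) = e , subst₂ (Mod _) (sym (+-suc _ _)) (sym (+-suc _ _)) (Mod-+ (Mod-refl {s = 1}) a)
      aligned-pred : ∀ {i s j t} → Aligned τ i (suc s) j (suc t) → Aligned τ i s j t
      aligned-pred (e , a) = e , Mod-cancel 1 (subst₂ (Mod _) (+-suc _ _) (+-suc _ _) a)
      E-app : ∀ x → app g x ≡ pt (cycle x) (suc (place x))
      E-app x = trans (cong (app g) (sym (pt-coordinates x))) (pt-suc _ _)

    described : ∃ λ M → IsEquivalence (Rel M) × relabel g M ≡ M × Describes M τ
    described = M ,
      record { refl = Rel-matrix⁺ E? aligned-refl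
             ; sym = λ r → Rel-matrix⁺ E? (aligned-sym (Rel-matrix⁻ E? r))
             ; trans = λ r r′ → Rel-matrix⁺ E? (aligned-trans (Rel-matrix⁻ E? r) (Rel-matrix⁻ E? r′)) } ,
      invariant⇒fixed g-perm (λ {x} {y} →
        (λ r → subst₂ (Rel M) (sym (E-app x)) (sym (E-app y)) (aligned⇒rel (aligned-suc (Rel-matrix⁻ E? r)))) ,
        (λ r → Rel-matrix⁺ E? (aligned-pred (rel⇒aligned (subst₂ (Rel M) (E-app x) (E-app y) r))))) ,
      record { rel⇒aligned = rel⇒aligned ; aligned⇒rel = aligned⇒rel }

module FromMatrix {n k : ℕ} {g : Perm n} (g-perm : IsPerm g) {l : Vec ℕ k} (𝒞 : Cycles (app g) l)
         {M : Matrix n} (equiv : IsEquivalence (Rel M)) (inv : Invariant {g = g} g-perm {M}) where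
  open Cycles 𝒞
  open IsEquivalence equiv renaming (refl to ~refl; sym to ~sym; trans to ~trans; reflexive to ~reflexive)

  private
    infix 4 _~_
    _~_ : Fin k × ℕ → Fin k × ℕ → Set
    (i , s) ~ (j , t) = Rel M (pt i s) (pt j t)

    shift⁺ : ∀ c {i s j t} → (i , s) ~ (j , t) → (i , c + s) ~ (j , c + t)
    shift⁺ zero    r = r
    shift⁺ (suc c) r = subst₂ (Rel M) (pt-suc _ _) (pt-suc _ _) (proj₁ inv (shift⁺ c r))

    shift⁻ : ∀ c {i s j t} → (i , c + s) ~ (j , c + t) → (i , s) ~ (j , t)
    shift⁻ zero    r = r
    shift⁻ (suc c) r = shift⁻ c (proj₂ inv (subst₂ (Rel M) (sym (pt-suc _ _)) (sym (pt-suc _ _)) r))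

    Joined : Fin k → Fin k → Set
    Joined i j = ∃ λ t → (i , 0) ~ (j , t)

    joined? : Decidable Joined
    joined? i j = map′ (λ (t , _ , r) → t , r)
      (λ (t , r) → t % lookup l j , m%n<n t (lookup l j) , subst (Rel M (pt i 0)) (Mod⇒pt (Mod-sym (Mod-% (lookup l j) t))) r)
      (anyUpTo? (λ t → Rel? M (pt i 0) (pt j t)) (lookup l j))
      where
      instance
        nz : NonZero (lookup l j)
        nz = >-nonZero (positive j)

    -- Advancing both points until the first completes a full turn brings it to its base point, so
    -- links need only be sought from there.
    ~⇒joined : ∀ {i s j t} → (i , s) ~ (j , t) → Joined i j
    ~⇒joined {i} {s} {j} {t} r with Mod-negate (positive i) s
    ... | u , e = u + t , subst (λ x → Rel M x (pt j (u + t)))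
                    (Mod⇒pt (Mod-trans (Mod-reflexive (+-comm u s)) e)) (shift⁺ u r)

    joined-sym : ∀ {i j} → Joined i j → Joined j i
    joined-sym (t , r) = ~⇒joined (~sym r)

    joined-trans : ∀ {i j h} → Joined i j → Joined j h → Joined i h
    joined-trans {i} {j} {h} (t , r) (u , r′) =
      t + u , ~trans r (subst (λ s → (j , s) ~ (h , t + u)) (+-identityʳ t) (shift⁺ t r′))

    -- The least joined cycle is taken, in keeping with the encoding of set partitions by least
    -- elements.
    root : ∀ i → ∃ λ j → Joined i j × (∀ {j′} → Joined i j′ → toℕ j ≤ toℕ j′)
    root i with least (λ m → any? (λ j → (toℕ j ≟ m) ×-dec joined? i j)) (i , refl , 0 , ~refl)
    ... | m , (j , refl , c) , minimal = j , c , λ {j′} c′ → ≮⇒≥ λ j′<j → minimal j′<j (j′ , refl , c′)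

    r : Fin k → Fin k
    r i = proj₁ (root i)

    r-joined : ∀ i → Joined i (r i)
    r-joined i = proj₁ (proj₂ (root i))

    r-minimal : ∀ i {j} → Joined i j → toℕ (r i) ≤ toℕ j
    r-minimal i = proj₂ (proj₂ (root i))

    joined⇒r≡ : ∀ {i j} → Joined i j → r i ≡ r j
    joined⇒r≡ {i} {j} c = toℕ-injective (≤-antisym
      (r-minimal i (joined-trans c (r-joined j))) (r-minimal j (joined-trans (joined-sym c) (r-joined i))))

    r-idem : ∀ i → r (r i) ≡ r i
    r-idem i = sym (joined⇒r≡ (r-joined i))

    shift : ∀ i → Shift (λ s t → (i , s) ~ (i , t))
    shift i = record
      { decidable   = λ s t → Rel? M (pt i s) (pt i t)
      ; equivalence = record { refl = ~refl ; sym = ~sym ; trans = ~trans }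
      ; shift⁺ = λ c → shift⁺ c ; shift⁻ = λ c → shift⁻ c }

    full-turn : ∀ i → (i , 0) ~ (i , lookup l i)
    full-turn i = ~reflexive (Mod⇒pt (∣⇒Mod-0 (divides 1 (sym (*-identityˡ _)))))

    periodic : ∀ i → ∃ (IsPeriod (λ s t → (i , s) ~ (i , t)))
    periodic i = period (shift i) (positive i) (full-turn i)

    d : Fin k → ℕ
    d i = proj₁ (periodic i)

    d-positive : ∀ i → 0 < d i
    d-positive i = proj₁ (proj₂ (periodic i))

    ~⇒Mod : ∀ i {s t} → (i , s) ~ (i , t) → Mod (d i) s t
    ~⇒Mod i = proj₁ (proj₂ (proj₂ (periodic i)))

    Mod⇒~ : ∀ i {s t} → Mod (d i) s t → (i , s) ~ (i , t)
    Mod⇒~ i = proj₂ (proj₂ (proj₂ (periodic i)))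

    slide : ∀ {i j u} → (i , 0) ~ (j , u) → ∀ c → (i , c) ~ (j , c + u)
    slide {i} {j} {u} q c = subst (λ s → (i , s) ~ (j , c + u)) (+-identityʳ c) (shift⁺ c q)

    -- Sliding along the link between the two cycles carries equivalences inside one to equivalences
    -- inside the other; hence a block has a single period.
    joined-periods : ∀ {i j s t} → Joined i j → (i , s) ~ (i , t) → (j , s) ~ (j , t)
    joined-periods {i} {j} {s} {t} (u , q) e = shift⁻ u
      (subst₂ (λ a b → (j , a) ~ (j , b)) (+-comm s u) (+-comm t u) (~trans (~sym (slide q s)) (~trans e (slide q t))))

    from-root : ∀ i → Joined (r i) i
    from-root i = joined-sym (r-joined i)

    -- A link from the root matters only modulo the period, so it is reduced below it. At the root
    -- itself 0 is prescribed, as the normal form requires.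
    offset : ∀ i → ∃ λ u → (r i , 0) ~ (i , u) × u < d (r i) × (r i ≡ i → u ≡ 0)
    offset i with r i ≟ᶠ i
    ... | yes e = 0 , ~reflexive (cong (λ j → pt j 0) e) , d-positive (r i) , λ _ → refl
    ... | no ¬e = let (t , q) = from-root i in
        t % d (r i) , ~trans q (joined-periods (from-root i) (Mod⇒~ (r i) (Mod-sym (Mod-% (d (r i)) t)))) ,
        m%n<n t (d (r i)) , ⊥-elim ∘ ¬e
      where
      instance
        nz : NonZero (d (r i))
        nz = >-nonZero (d-positive (r i))

    o : Fin k → ℕ
    o i = proj₁ (offset i)

    o-base : ∀ i → (r i , 0) ~ (i , o i)
    o-base i = proj₁ (proj₂ (offset i))

    F : Vec (Fin k) k
    F = V.tabulate r
    D O : Vec ℕ k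
    D = V.tabulate (λ i → ifDec (r i ≟ᶠ i) (d i) 0)
    O = V.tabulate o

    F≡ : ∀ i → lookup F i ≡ r i
    F≡ = lookup∘tabulate r

    O≡ : ∀ i → lookup O i ≡ o i
    O≡ = lookup∘tabulate o

    D≡ : ∀ i → lookup D (lookup F i) ≡ d (r i)
    D≡ i = trans (cong (lookup D) (F≡ i)) (trans (lookup∘tabulate _ (r i)) (ifDec-yes (r (r i) ≟ᶠ r i) (r-idem i)))

    isTriple : IsTriple g-perm 𝒞 (F , D , O)
    isTriple = record
      { root≤     = λ i → subst (λ j → toℕ j ≤ toℕ i) (sym (F≡ i)) (r-minimal i (0 , ~refl))
      ; root-root = λ i → trans (cong (lookup F) (F≡ i)) (trans (F≡ (r i)) (trans (r-idem i) (sym (F≡ i))))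
      } , record
      { period-positive = λ i → subst (0 <_) (sym (D≡ i)) (d-positive (r i))
      -- A full turn of cycle `i` preserves the classes on it, hence is also a multiple of the
      -- period at its root.
      ; period-∣        = λ i → subst (_∣ lookup l i) (sym (D≡ i))
                            (Mod-0⇒∣ (~⇒Mod (r i) (joined-periods (r-joined i) (full-turn i))))
      ; period-0        = λ i ¬e → trans (lookup∘tabulate _ i) (ifDec-no (r i ≟ᶠ i) (¬e ∘ trans (F≡ i)))
      ; offset-0        = λ i e → trans (O≡ i) (proj₂ (proj₂ (proj₂ (offset i))) (trans (sym (F≡ i)) e))
      ; offset-<        = λ i → subst₂ _<_ (sym (O≡ i)) (sym (D≡ i)) (proj₁ (proj₂ (proj₂ (offset i))))
      }

    rotate : ∀ a b s → a + b + s ≡ b + s + a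
    rotate = solve-∀

    rotate′ : ∀ a b t → a + b + t ≡ a + t + b
    rotate′ = solve-∀

    -- Both points are advanced by `o i + o j`; each then slides back to the common root cycle, at
    -- position `o j + s` or `o i + t`, where equivalence is congruence modulo the period.
    ~⇒aligned : ∀ {i s j t} → (i , s) ~ (j , t) → r i ≡ r j × Mod (d (r i)) (o j + s) (o i + t)
    ~⇒aligned {i} {s} {j} {t} q = e , ~⇒Mod (r i) (~trans (slide (o-base i) (o j + s)) (~trans
        (subst₂ (λ a b → (i , a) ~ (j , b)) (rotate (o i) (o j) s) (rotate′ (o i) (o j) t) (shift⁺ (o i + o j) q))
        (~sym (subst (λ x → (x , o i + t) ~ (j , o i + t + o j)) (sym e) (slide (o-base j) (o i + t))))))
      where
      e : r i ≡ r j
      e = joined⇒r≡ (~⇒joined q)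

    aligned⇒~ : ∀ {i s j t} → r i ≡ r j → Mod (d (r i)) (o j + s) (o i + t) → (i , s) ~ (j , t)
    aligned⇒~ {i} {s} {j} {t} e a = shift⁻ (o i + o j)
      (subst₂ (λ a b → (i , a) ~ (j , b)) (sym (rotate (o i) (o j) s)) (sym (rotate′ (o i) (o j) t))
        (~trans (~sym (slide (o-base i) (o j + s))) (~trans (Mod⇒~ (r i) a)
          (subst (λ x → (x , o i + t) ~ (j , o i + t + o j)) (sym e) (slide (o-base j) (o i + t))))))

  describing : ∃ λ τ → IsTriple g-perm 𝒞 τ × Describes g-perm 𝒞 M τ
  describing = (F , D , O) , isTriple , record
    { rel⇒aligned = λ {i} {s} {j} {t} q → let (e , a) = ~⇒aligned q in
        trans (F≡ i) (trans e (sym (F≡ j))) ,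
        Mod-modulus (sym (D≡ i)) (subst₂ (Mod _) (cong (_+ s) (sym (O≡ j))) (cong (_+ t) (sym (O≡ i))) a)
    ; aligned⇒rel = λ {i} {s} {j} {t} (e , a) → aligned⇒~ (trans (sym (F≡ i)) (trans e (F≡ j)))
        (Mod-modulus (D≡ i) (subst₂ (Mod _) (cong (_+ s) (O≡ j)) (cong (_+ t) (O≡ i)) a))
    }

-- Relations fixed by a permutation of given type, and the final count

typeWeight : ∀ {k} → Vec ℕ k → ℕ
typeWeight {k} l = ∑ (SetPar k) (λ π → ∏ (blocks π) (λ c → σ (map (lookup l) c)))

-- Being fixed by relabelling is invariance, and `Describes` matches the invariant relations with
-- the normalised triples.
fixed≡typeWeight : ∀ {n k} {g : Perm n} {l : Vec ℕ k} → IsPerm g → Cycles (app g) l →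
                   Action.fixed (relabelling n) g ≡ typeWeight l
fixed≡typeWeight {n} {k} {g} {l} g-perm 𝒞 = begin
  Action.fixed (relabelling n) g                    ≡⟨ ∑-𝟙 fixed? equivalences ⟩
  length (filter fixed? equivalences)               ≡⟨ bijection⇒length≡ (Describes g-perm 𝒞)
    (Unique.filter⁺ fixed? equivalences-unique) (triples-unique g-perm 𝒞)
    (λ {M} M∈ → let (p , e) = ∈-filter⁻ fixed? {xs = equivalences} M∈
                    (τ , t , δ) = FromMatrix.describing g-perm 𝒞 {M} (∈-equivalences⁻ p) (fixed⇒invariant g-perm e)
                in τ , ∈-triples⁺ g-perm 𝒞 t , δ)
    (λ {τ} τ∈ → let (M , eq , e , δ) = FromTriple.described g-perm 𝒞 (∈-triples⁻ g-perm 𝒞 τ∈)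
                in M , ∈-filter⁺ fixed? (∈-equivalences⁺ eq) e , δ)
    (λ _ _ → describes-injectiveˡ g-perm 𝒞)
    (λ τ∈ τ′∈ → describes-injectiveʳ g-perm 𝒞 (∈-triples⁻ g-perm 𝒞 τ∈) (∈-triples⁻ g-perm 𝒞 τ′∈)) ⟩
  length (triples g-perm 𝒞)                         ≡⟨ length-concatMap _ (SetPar k) ⟩
  ∑ (SetPar k) (λ f → length (map (f ,_) (labellings l f)))
    ≡⟨ ∑-cong (SetPar k) (λ {f} f∈ → trans (length-map (f ,_) (labellings l f)) (length-labellings l f (∈-SetPar⁻ f f∈))) ⟩
  typeWeight l                                      ∎
  where
  open ≡-Reasoning
  fixed? : ∀ M → Dec (relabel g M ≡ M)
  fixed? M = Action._≟ₚ_ (relabelling n) (relabel g M) M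

formula≡ : ∀ n → formula n ≡ ∑ (cycleTypes n) (λ κ → typeWeight (proj₂ κ))
formula≡ n = sym (trans (∑-concatMap _ (λ k → map (k ,_) (par k n)) (map suc (upTo n)))
  (∑-cong (map suc (upTo n)) λ {k} _ → ∑-map _ (k ,_) (par k n)))

theorem9 : ∀ (n : ℕ) → 1 ≤ n →
    Σ (List (MMSystem n)) λ reps →
    (length reps ≡ formula n)
    × (∀ (S : MMSystem n) → ∃ λ R → (R ∈ reps) × Iso S R)
    × AllPairs (λ R T → ¬ Iso R T) reps
theorem9 n 1≤n = reps , length≡ , complete , distinct
  where
  open ≡-Reasoning
  rs : List (Perm n × Matrix n)
  rs = deduplicate Systems.orbit? Systems.points
  rs-transversal : Systems.Transversal rs
  rs-transversal = record
    { ⊆points = deduplicate-⊆ Systems.orbit? Systems.orbit-equivalence Systems.points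
    ; apart   = deduplicate-apart Systems.orbit? Systems.orbit-equivalence Systems.points
    ; cover   = deduplicate-cover Systems.orbit? Systems.orbit-equivalence Systems.points
    }
  open Systems.Transversal rs-transversal
  -- Orbits are counted among the finitely many pairs; only the chosen representatives are turned
  -- back into systems.
  decoded : ∃ λ reps → Pointwise (λ x S → code S ≡ x) rs reps
  decoded = choose rs (decode ∘ ⊆points)
  reps : List (MMSystem n)
  reps = proj₁ decoded
  classes : ∃ λ cs → Conjugacy.Transversal cs × Pointwise HasType (cycleTypes n) cs
  classes = conjugacyClasses 1≤n
  length≡ : length reps ≡ formula n
  length≡ = begin
    length reps                                              ≡⟨ sym (Pointwise-length (proj₂ decoded)) ⟩
    length rs                                                ≡⟨ length-pairing-transversal (symmetricGroup n) (relabelling n) rs-transversal (proj₁ (proj₂ classes)) ⟩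
    ∑ (proj₁ classes) (Action.fixed (relabelling n))         ≡⟨ sym (∑-Pointwise (λ (g-perm , 𝒞 , _) → sym (fixed≡typeWeight g-perm 𝒞)) (proj₂ (proj₂ classes))) ⟩
    ∑ (cycleTypes n) (λ κ → typeWeight (proj₂ κ))            ≡⟨ sym (formula≡ n) ⟩
    formula n                                                ∎
  complete : ∀ S → ∃ λ R → (R ∈ reps) × Iso S R
  complete S =
    let (x , x∈ , o) = cover (code∈points S)
        (R , R∈ , e) = Pointwise-∈ˡ (proj₂ decoded) x∈
    in R , R∈ , orbit⇒iso S R (subst (Systems.Orbit (code S)) (sym e) o)
  distinct : AllPairs (λ R T → ¬ Iso R T) reps
  distinct = Pointwise-AllPairs (λ {x} {x′} {R} {R′} e e′ ¬o i → ¬o (subst₂ Systems.Orbit e e′ (iso⇒orbit R R′ i)))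
    (proj₂ decoded) apart
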